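{- Let $F(x,y,q)=\sum_{P\in\mathcal F}x^{\mathrm{xper}(P)}y^{\mathrm{yper}(P)}q^{\mathrm{area}(P)}$ be the generating function of all (nonempty) Fibonacci polyominoes counted by horizontal semiperimeter, vertical semiperimeter and area, regarded as a formal power series. Then \[ F(x,y,q) = \frac{ \displaystyle\sum_{\ell\geq 0} \frac{(xy)^{\ell+1}q^{(\ell+1)^2}(y-1)^\ell} {1-yq^{\ell+1}} \prod_{i=0}^{\ell-1} \frac{1}{(1-yq^{i+1})(1-q^{i+1})} }{ 1- \displaystyle\sum_{\ell\geq 0} \frac{(xy)^{\ell+1}q^{(\ell+1)(\ell+2)}(y-1)^\ell} {1-q^{\ell+1}} \prod_{i=0}^{\ell-1} \frac{1}{(1-yq^{i+1})(1-q^{i+1})} }, \] where an empty product equals $1$.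
   Context: A Fibonacci polyomino is a (nonempty) polyomino, considered up to translation, that is column-convex (each column is a contiguous segment of unit cells) and such that, reading columns from left to right, the bottom cell of each column lies exactly one unit above the bottom cell of the preceding column. Equivalently, it is given by a sequence of column heights $(h_1,\dots,h_m)$, $m\ge 1$, with $h_i\ge 2$ for $1\le i\le m-1$ and $h_m\ge 1$; column $i$ consists of the cells in column position $i$ and rows $i,i+1,\dots,i+h_i-1$. $\mathcal F$ is the set of all Fibonacci polyominoes. The area $\mathrm{area}(P)$ is the number of cells. The horizontal semiperimeter $\mathrm{xper}(P)$ is half the number of horizontal unit edges on the boundary of $P$, and the vertical semiperimeter $\mathrm{yper}(P)$ is half the number of vertical unit edges on the boundary of $P$ (a boundary edge is a unit edge belonging to exactly one cell of $P$). -}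

module Defs where

open import Algebra.Bundles.Raw using (RawRing)
import Algebra.Definitions.RawSemiring as RawSemiringDefinitions
open import Algebra.Properties.CommutativeSemigroup using (interchange)
open import Data.Fin.Base using (Fin)
open import Data.Integer.Base as ℤ using (ℤ; +_; 0ℤ; 1ℤ)
import Data.Integer.Properties as ℤ
open import Data.List.Base using (List; []; _∷_; _++_; map; concatMap; filter; length; upTo)
open import Data.Nat.Base as ℕ using (ℕ; zero; suc; _∸_; ⌊_/2⌋; z≤n; s≤s)
import Data.Nat.Properties as ℕ
open import Data.Product.Base using (Σ-syntax; ∃-syntax; _×_; _,_)
open import Data.Sum.Base using (inj₁; inj₂)
open import Data.Product.Properties using (≡-dec)
open import Function.Bundles using (_↔_)
open import Level using (0ℓ)
open import Relation.Binary.Definitions using (DecidableEquality)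
open import Relation.Binary.PropositionalEquality using (_≡_; refl; sym; trans; cong; cong₂; subst; module ≡-Reasoning)

-- The sequence of column heights determines the polyomino up to translation.
data IsFibonacci : List ℕ → Set where
  lastColumn : ∀ {h} → 1 ℕ.≤ h → IsFibonacci (h ∷ [])
  _∷_        : ∀ {h hs} → 2 ℕ.≤ h → IsFibonacci hs → IsFibonacci (h ∷ hs)

record FibonacciPolyomino : Set where
  constructor polyomino
  field
    heights     : List ℕ
    isFibonacci : IsFibonacci heights

open FibonacciPolyomino public

-- (column , row)
Cell : Set
Cell = ℕ × ℕ

-- The first column of the list is placed in column i, with bottom cell in row i.
cellsFrom : ℕ → List ℕ → List Cell
cellsFrom i []       = []
cellsFrom i (h ∷ hs) = map (λ k → i , i ℕ.+ k) (upTo h) ++ cellsFrom (suc i) hs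

cells : FibonacciPolyomino → List Cell
cells P = cellsFrom 1 (heights P)

area : FibonacciPolyomino → ℕ
area P = length (cells P)

-- A horizontal edge (i , j) is the lower side of the cell (i , j), and a
-- vertical edge (i , j) is its left side.
Edge : Set
Edge = ℕ × ℕ

_≟ᴱ_ : DecidableEquality Edge
_≟ᴱ_ = ≡-dec ℕ._≟_ ℕ._≟_

horizontalSides : Cell → List Edge
horizontalSides (i , j) = (i , j) ∷ (i , suc j) ∷ []

verticalSides : Cell → List Edge
verticalSides (i , j) = (i , j) ∷ (suc i , j) ∷ []

multiplicity : Edge → List Edge → ℕ
multiplicity e es = length (filter (e ≟ᴱ_) es)

-- The list cells P has no repetitions, so the multiplicity of e in
-- concatMap sides (cells P) is the number of cells of P having e as a side;
-- an edge of multiplicity one is listed exactly once.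
boundary : (Cell → List Edge) → FibonacciPolyomino → List Edge
boundary sides P = filter (λ e → multiplicity e es ℕ.≟ 1) es
  where es = concatMap sides (cells P)

-- The boundary has an even number of edges in each direction, so the
-- rounding in ⌊_/2⌋ has no effect.
xper : FibonacciPolyomino → ℕ
xper P = ⌊ length (boundary horizontalSides P) /2⌋

yper : FibonacciPolyomino → ℕ
yper P = ⌊ length (boundary verticalSides P) /2⌋

-- f a b n is the coefficient of xᵃ yᵇ qⁿ.
Series : Set
Series = ℕ → ℕ → ℕ → ℤ

∑ : ℕ → (ℕ → ℤ) → ℤ
∑ zero    t = 0ℤ
∑ (suc n) t = ∑ n t ℤ.+ t n

syntax ∑ n (λ i → t) = ∑[ i < n ] t

infix  4 _≈_
infixl 6 _+_ _-_
infixl 7 _*_ _/_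

_≈_ : Series → Series → Set
f ≈ g = ∀ a b n → f a b n ≡ g a b n

0# 1# X Y Q : Series

0# _ _ _ = 0ℤ

1# 0 0 0 = 1ℤ
1# _ _ _ = 0ℤ

X 1 0 0 = 1ℤ
X _ _ _ = 0ℤ

Y 0 1 0 = 1ℤ
Y _ _ _ = 0ℤ

Q 0 0 1 = 1ℤ
Q _ _ _ = 0ℤ

_+_ _-_ _*_ : Series → Series → Series
(f + g) a b n = f a b n ℤ.+ g a b n
(f - g) a b n = f a b n ℤ.- g a b n
(f * g) a b n =
  ∑[ i < suc a ] ∑[ j < suc b ] ∑[ k < suc n ]
    (f i j k ℤ.* g (a ∸ i) (b ∸ j) (n ∸ k))

-_ : Series → Series
(- f) a b n = ℤ.- f a b n

rawRing : RawRing 0ℓ 0ℓ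
rawRing = record
  { Carrier = Series ; _≈_ = _≈_ ; _+_ = _+_ ; _*_ = _*_ ; -_ = -_ ; 0# = 0# ; 1# = 1# }

open RawSemiringDefinitions (RawRing.rawSemiring rawRing) public using (_^_)

∏ : ℕ → (ℕ → Series) → Series
∏ zero    t = 1#
∏ (suc n) t = ∏ n t * t n

syntax ∏ n (λ i → t) = ∏[ i < n ] t

-- This is the sum of the family f whenever every f ℓ has order at least ℓ
-- (see ∑∞-isSum), as is the case wherever it is used below.
∑∞ : (ℕ → Series) → Series
∑∞ f a b n = ∑[ ℓ < suc (a ℕ.+ b ℕ.+ n) ] f ℓ a b n

-- The geometric series in 1# - f: the inverse of f whenever f has constant
-- term 1 (see *-inverseʳ), as is the case wherever it is used below.
infix 8 _⁻¹
_⁻¹ : Series → Series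
f ⁻¹ = ∑∞ (λ k → (1# - f) ^ k)

_/_ : Series → Series → Series
f / g = f * g ⁻¹

IsGeneratingFunction : Series → Set
IsGeneratingFunction F = ∀ a b n → ∃[ c ]
  F a b n ≡ + c ×
  Fin c ↔ (Σ[ P ∈ FibonacciPolyomino ] xper P ≡ a × yper P ≡ b × area P ≡ n)

commonProduct : ℕ → Series
commonProduct ℓ =
  ∏[ i < ℓ ] (1# / ((1# - Y * Q ^ (i ℕ.+ 1)) * (1# - Q ^ (i ℕ.+ 1))))

numeratorTerm : ℕ → Series
numeratorTerm ℓ =
  ((X * Y) ^ (ℓ ℕ.+ 1) * Q ^ ((ℓ ℕ.+ 1) ℕ.^ 2) * (Y - 1#) ^ ℓ) / (1# - Y * Q ^ (ℓ ℕ.+ 1))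
    * commonProduct ℓ

denominatorTerm : ℕ → Series
denominatorTerm ℓ =
  ((X * Y) ^ (ℓ ℕ.+ 1) * Q ^ ((ℓ ℕ.+ 1) ℕ.* (ℓ ℕ.+ 2)) * (Y - 1#) ^ ℓ) / (1# - Q ^ (ℓ ℕ.+ 1))
    * commonProduct ℓ

OrderAtLeast : ℕ → Series → Set
OrderAtLeast k f = ∀ a b n → a ℕ.+ b ℕ.+ n ℕ.< k → f a b n ≡ 0ℤ

-- Every coefficient of the partial sums is eventually that of S.
IsSum : (ℕ → Series) → Series → Set
IsSum f S = ∀ a b n → ∃[ N ] ∀ M → N ℕ.≤ M → ∑[ ℓ < M ] f ℓ a b n ≡ S a b n

module SeriesLemmas where

  ∑-cong : ∀ n {t t′ : ℕ → ℤ} → (∀ i → i ℕ.< n → t i ≡ t′ i) → ∑ n t ≡ ∑ n t′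
  ∑-cong zero    eq = refl
  ∑-cong (suc n) eq =
    cong₂ ℤ._+_ (∑-cong n (λ i i<n → eq i (ℕ.m<n⇒m<1+n i<n))) (eq n (ℕ.n<1+n n))

  ∑-zero : ∀ n {t : ℕ → ℤ} → (∀ i → t i ≡ 0ℤ) → ∑ n t ≡ 0ℤ
  ∑-zero zero    t≡0 = refl
  ∑-zero (suc n) t≡0 = cong₂ ℤ._+_ (∑-zero n t≡0) (t≡0 n)

  ∑-+ : ∀ n (t t′ : ℕ → ℤ) → ∑[ i < n ] (t i ℤ.+ t′ i) ≡ ∑ n t ℤ.+ ∑ n t′
  ∑-+ zero    t t′ = refl
  ∑-+ (suc n) t t′ = trans
    (cong (ℤ._+ (t n ℤ.+ t′ n)) (∑-+ n t t′))
    (interchange ℤ.+-commutativeSemigroup (∑ n t) (∑ n t′) (t n) (t′ n))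

  ∑-extend : ∀ {N M} (t : ℕ → ℤ) → (∀ ℓ → N ℕ.≤ ℓ → t ℓ ≡ 0ℤ) → N ℕ.≤ M → ∑ M t ≡ ∑ N t
  ∑-extend {N} t t≡0 N≤M = go (ℕ.≤⇒≤′ N≤M)
    where
    go : ∀ {M} → N ℕ.≤′ M → ∑ M t ≡ ∑ N t
    go (ℕ.≤′-reflexive refl) = refl
    go (ℕ.≤′-step N≤M)       =
      trans (cong₂ ℤ._+_ (go N≤M) (t≡0 _ (ℕ.≤′⇒≤ N≤M))) (ℤ.+-identityʳ _)

  ∑-head : ∀ n {t : ℕ → ℤ} → (∀ i → t (suc i) ≡ 0ℤ) → ∑ (suc n) t ≡ t 0
  ∑-head zero    t≡0 = ℤ.+-identityˡ _
  ∑-head (suc n) t≡0 = trans (cong₂ ℤ._+_ (∑-head n t≡0) (t≡0 n)) (ℤ.+-identityʳ _)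

  ∑³ : ℕ → ℕ → ℕ → Series → ℤ
  ∑³ a b n h = ∑[ i < suc a ] ∑[ j < suc b ] ∑[ k < suc n ] h i j k

  ∑³-cong : ∀ a b n {h h′ : Series} →
            (∀ i j k → i ℕ.≤ a → j ℕ.≤ b → k ℕ.≤ n → h i j k ≡ h′ i j k) →
            ∑³ a b n h ≡ ∑³ a b n h′
  ∑³-cong a b n eq =
    ∑-cong (suc a) λ i i≤a → ∑-cong (suc b) λ j j≤b → ∑-cong (suc n) λ k k≤n →
      eq i j k (ℕ.≤-pred i≤a) (ℕ.≤-pred j≤b) (ℕ.≤-pred k≤n)

  ∑³-zero : ∀ a b n → ∑³ a b n 0# ≡ 0ℤ
  ∑³-zero a b n = ∑-zero (suc a) λ i → ∑-zero (suc b) λ j → ∑-zero (suc n) λ k → refl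

  ∑³-+ : ∀ a b n (h h′ : Series) → ∑³ a b n (h + h′) ≡ ∑³ a b n h ℤ.+ ∑³ a b n h′
  ∑³-+ a b n h h′ = trans
    (∑-cong (suc a) λ i _ → trans (∑-cong (suc b) λ j _ → ∑-+ (suc n) _ _) (∑-+ (suc b) _ _))
    (∑-+ (suc a) _ _)

  *-identityˡ : ∀ g → 1# * g ≈ g
  *-identityˡ g a b n = begin
    (1# * g) a b n
      ≡⟨ ∑-head a (λ i → ∑-zero (suc b) λ j → ∑-zero (suc n) λ k → refl) ⟩
    ∑[ j < suc b ] ∑[ k < suc n ] (1# 0 j k ℤ.* g a (b ∸ j) (n ∸ k))
      ≡⟨ ∑-head b (λ j → ∑-zero (suc n) λ k → refl) ⟩
    ∑[ k < suc n ] (1# 0 0 k ℤ.* g a b (n ∸ k))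
      ≡⟨ ∑-head n (λ k → refl) ⟩
    1ℤ ℤ.* g a b n
      ≡⟨ ℤ.*-identityˡ _ ⟩
    g a b n ∎
    where open ≡-Reasoning

  *-order : ∀ {p r f g} → OrderAtLeast p f → OrderAtLeast r g → OrderAtLeast (p ℕ.+ r) (f * g)
  *-order {p} {r} {f} {g} of og a b n lt =
    trans (∑³-cong a b n {h′ = 0#} vanish) (∑³-zero a b n)
    where
    split : ∀ i j k → i ℕ.≤ a → j ℕ.≤ b → k ℕ.≤ n →
            (i ℕ.+ j ℕ.+ k) ℕ.+ ((a ∸ i) ℕ.+ (b ∸ j) ℕ.+ (n ∸ k)) ≡ a ℕ.+ b ℕ.+ n
    split i j k i≤a j≤b k≤n = trans
      (interchange ℕ.+-commutativeSemigroup (i ℕ.+ j) k ((a ∸ i) ℕ.+ (b ∸ j)) (n ∸ k))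
      (cong₂ ℕ._+_
        (trans (interchange ℕ.+-commutativeSemigroup i j (a ∸ i) (b ∸ j)) (cong₂ ℕ._+_ (ℕ.m+[n∸m]≡n i≤a) (ℕ.m+[n∸m]≡n j≤b)))
        (ℕ.m+[n∸m]≡n k≤n))
    vanish : ∀ i j k → i ℕ.≤ a → j ℕ.≤ b → k ℕ.≤ n →
             f i j k ℤ.* g (a ∸ i) (b ∸ j) (n ∸ k) ≡ 0ℤ
    vanish i j k i≤a j≤b k≤n with ℕ.<-≤-connex (i ℕ.+ j ℕ.+ k) p
    ... | inj₁ small rewrite of i j k small = refl
    ... | inj₂ large = trans
      (cong (f i j k ℤ.*_) (og _ _ _ (ℕ.+-cancelˡ-< p _ r
        (ℕ.≤-<-trans (ℕ.+-monoˡ-≤ _ large) (subst (ℕ._< p ℕ.+ r) (sym (split i j k i≤a j≤b k≤n)) lt)))))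
      (ℤ.*-zeroʳ (f i j k))

  ^-order : ∀ {u} → OrderAtLeast 1 u → ∀ k → OrderAtLeast k (u ^ k)
  ^-order ou zero    a b n ()
  ^-order ou (suc k) = *-order ou (^-order ou k)

open SeriesLemmas

∑∞-isSum : ∀ f → (∀ ℓ → OrderAtLeast ℓ (f ℓ)) → IsSum f (∑∞ f)
∑∞-isSum f of a b n =
  suc (a ℕ.+ b ℕ.+ n) , λ M → ∑-extend (λ ℓ → f ℓ a b n) (λ ℓ → of ℓ a b n)

*-inverseʳ : ∀ f → f 0 0 0 ≡ 1ℤ → f * f ⁻¹ ≈ 1#
*-inverseʳ f f₀≡1 a b n = begin
  (f * f ⁻¹) a b n
    ≡⟨ ∑³-cong a b n (λ i j k _ _ _ → cong (f i j k ℤ.*_) (sym (truncate i j k))) ⟩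
  (f * S N) a b n
    ≡⟨ ℤ.+-identityʳ _ ⟨
  (f * S N) a b n ℤ.+ 0ℤ
    ≡⟨ cong (λ t → (f * S N) a b n ℤ.+ t) (^-order ou N a b n ℕ.≤-refl) ⟨
  (f * S N + u ^ N) a b n
    ≡⟨ telescope N a b n ⟩
  1# a b n ∎
  where
  open ≡-Reasoning
  N = suc (a ℕ.+ b ℕ.+ n)
  u = 1# - f

  S : ℕ → Series
  S M a b n = ∑[ k < M ] (u ^ k) a b n

  ou : OrderAtLeast 1 u
  ou 0 0 0 _ rewrite f₀≡1 = refl
  ou 0 0 (suc _) (s≤s ())
  ou 0 (suc _) _ (s≤s ())
  ou (suc _) _ _ (s≤s ())

  truncate : ∀ i j k → S N (a ∸ i) (b ∸ j) (n ∸ k) ≡ (f ⁻¹) (a ∸ i) (b ∸ j) (n ∸ k)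
  truncate i j k = ∑-extend (λ ℓ → (u ^ ℓ) (a ∸ i) (b ∸ j) (n ∸ k)) (λ ℓ → ^-order ou ℓ _ _ _)
    (s≤s (ℕ.+-mono-≤ (ℕ.+-mono-≤ (ℕ.m∸n≤m a i) (ℕ.m∸n≤m b j)) (ℕ.m∸n≤m n k)))

  absorb : ∀ g → f * g + u * g ≈ g
  absorb g a b n = begin
    (f * g + u * g) a b n
      ≡⟨ ∑³-+ a b n (λ i j k → f i j k ℤ.* g (a ∸ i) (b ∸ j) (n ∸ k))
                    (λ i j k → u i j k ℤ.* g (a ∸ i) (b ∸ j) (n ∸ k)) ⟨
    ∑³ a b n (λ i j k → f i j k ℤ.* g (a ∸ i) (b ∸ j) (n ∸ k) ℤ.+ u i j k ℤ.* g (a ∸ i) (b ∸ j) (n ∸ k))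
      ≡⟨ ∑³-cong a b n (λ i j k _ _ _ → trans
           (sym (ℤ.*-distribʳ-+ (g (a ∸ i) (b ∸ j) (n ∸ k)) (f i j k) (u i j k)))
           (cong (ℤ._* g (a ∸ i) (b ∸ j) (n ∸ k)) (cancel (f i j k) (1# i j k)))) ⟩
    (1# * g) a b n
      ≡⟨ *-identityˡ g a b n ⟩
    g a b n ∎
    where
    cancel : ∀ s t → s ℤ.+ (t ℤ.- s) ≡ t
    cancel s t = trans (ℤ.+-comm s (t ℤ.- s)) (trans (ℤ.+-assoc t (ℤ.- s) s)
      (trans (cong (λ r → t ℤ.+ r) (ℤ.+-inverseˡ s)) (ℤ.+-identityʳ t)))

  telescope : ∀ M → f * S M + u ^ M ≈ 1#
  telescope zero a b n = trans
    (cong (ℤ._+ 1# a b n) (trans (∑³-cong a b n {h′ = 0#} (λ i j k _ _ _ → ℤ.*-zeroʳ (f i j k))) (∑³-zero a b n)))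
    (ℤ.+-identityˡ _)
  telescope (suc M) a b n = begin
    (f * S (suc M)) a b n ℤ.+ (u ^ suc M) a b n
      ≡⟨ cong (ℤ._+ (u ^ suc M) a b n) (trans
           (∑³-cong a b n (λ i j k _ _ _ →
             ℤ.*-distribˡ-+ (f i j k) (S M (a ∸ i) (b ∸ j) (n ∸ k)) ((u ^ M) (a ∸ i) (b ∸ j) (n ∸ k))))
           (∑³-+ a b n (λ i j k → f i j k ℤ.* S M (a ∸ i) (b ∸ j) (n ∸ k))
                       (λ i j k → f i j k ℤ.* (u ^ M) (a ∸ i) (b ∸ j) (n ∸ k)))) ⟩
    ((f * S M) a b n ℤ.+ (f * u ^ M) a b n) ℤ.+ (u * u ^ M) a b n
      ≡⟨ ℤ.+-assoc ((f * S M) a b n) _ _ ⟩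
    (f * S M) a b n ℤ.+ (f * u ^ M + u * u ^ M) a b n
      ≡⟨ cong (λ t → (f * S M) a b n ℤ.+ t) (absorb (u ^ M) a b n) ⟩
    (f * S M + u ^ M) a b n
      ≡⟨ telescope M a b n ⟩
    1# a b n ∎

{-# OPTIONS --safe #-}
-- With heights (h₁,…,hₘ) one has xper = m, area = Σ hᵢ and
-- yper = hₘ + Σ max (hᵢ - hᵢ₊₁) 1.  Let H k be the generating function of the
-- polyominoes with h₁ = k + 1.  Removing the first column gives
--   H k = x q^(k+1) A k  for k ≥ 1,   H 0 = x q y,
--   where A k = y^(k+1) + Σⱼ y^(max (k-j) 1) H j.
-- Consecutive A k differ by a finite sum:
--   A (k+1) = A k + (y-1) B k,   B (k+1) = y (B k + H k),   B 0 = y,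
-- so multiplying by t^k and summing over k yields, for
-- Φ s = Σₖ s^(k+1) H k and t = s q, the equation
--   Φ s = xyt / (1-yt) + xyt² / (1-t) · F + xyt² (y-1) / ((1-yt)(1-t)) · Φ t.
-- Iterating it from Φ 1 = F along s = 1, q, q², … expresses F linearly in
-- itself, the coefficients being the numerator and denominator series.
module Submission where

open import Algebra.Bundles using (CommutativeRing)
open import Algebra.Bundles.Raw using (RawRing)
import Algebra.Morphism.RingMonomorphism as RingMonomorphism
open import Algebra.Morphism.Structures using (IsRingMonomorphism)
import Algebra.Properties.CommutativeSemigroup as CommutativeSemigroupProperties
import Algebra.Properties.Group as GroupProperties
import Algebra.Solver.Ring.NaturalCoefficients.Default as SemiringSolver
open import Algebra.Structures using (IsCommutativeRing)
open import Data.Integer.Base as ℤ using (ℤ; 0ℤ; 1ℤ)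
import Data.Integer.Properties as ℤ
open import Data.Nat.Base as ℕ using (ℕ; zero; suc; _∸_; ⌊_/2⌋; _≤_; _<_; s≤s; z≤n)
import Data.Nat.Properties as ℕ
open import Data.Product.Base using (Σ-syntax; ∃-syntax; _×_; _,_; proj₁; proj₂)
open import Function.Base using (id; _∘_)
open import Level using (0ℓ)
open import Relation.Binary.PropositionalEquality as ≡ using (_≡_; _≢_; refl; sym; trans; cong; cong₂; subst; module ≡-Reasoning)
import Relation.Binary.Reasoning.Setoid as SetoidReasoning
import Defs

-- Semiperimeters and area in terms of the column heights

-- A first column of height 1 must be the last one, so `H 0` breaks the pattern of the other `H k`.
-- The sum is still taken over `A k` for all k, and the surplus y F contained in `A 0` is removed
-- afterwards: this turns the coefficient xyt / (1-t) of F into xyt² / (1-t). The height lists are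
-- enumerated by the same recursion that the series satisfy, with a shift of the index in place of
-- multiplication by a monomial, so taking lengths gives the recursion for `H`. The iteration
-- converges because every step contributes a factor xy to the coefficient of the remainder.

module Boundary where

  open import Data.List.Base using (List; []; _∷_; _++_; map; concatMap; filter; length; upTo; applyUpTo)
  open import Data.List.Membership.Propositional using (_∈_; _∉_)
  open import Data.List.Properties using (length-map; length-++; length-upTo; concatMap-++; filter-++; filter-all; filter-none; map-upTo; ++-assoc; ++-identityʳ)
  open import Data.List.Relation.Binary.Disjoint.Propositional using (Disjoint)
  open import Data.List.Relation.Binary.Permutation.Propositional using (_↭_; ↭-sym; ↭-trans; ↭-refl; ↭-reflexive; prep)
  open import Data.List.Relation.Binary.Permutation.Propositional.Properties using (filter-↭; ↭-length; shift; ++⁺ˡ; ++⁺ʳ)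
  open import Data.List.Relation.Unary.All as All using (All; []; _∷_)
  import Data.List.Relation.Unary.All.Properties as All
  open import Data.List.Relation.Unary.Any using (here; there)
  open import Data.Nat.Base using (_+_; ∣_-_∣)
  open import Data.Nat.ListAction using (sum)
  open import Data.Nat.Solver using (module +-*-Solver)
  open import Function.Bundles using (_⇔_; mk⇔; Equivalence)
  open import Relation.Nullary using (¬_; yes; no; contradiction)
  open import Relation.Unary using (Decidable)
  open Defs using (Cell; Edge; _≟ᴱ_; multiplicity; horizontalSides; verticalSides; cellsFrom; polyomino; IsFibonacci; lastColumn; _∷_; xper; yper; area; heights)
  open ≡-Reasoning

  -- The length of the `boundary` as a function of the list of sides alone, so that this list can be
  -- permuted and split.
  once : List Edge → ℕ
  once es = length (filter (λ e → multiplicity e es ℕ.≟ 1) es)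

  multiplicity-↭ : ∀ e {xs ys} → xs ↭ ys → multiplicity e xs ≡ multiplicity e ys
  multiplicity-↭ e = ↭-length ∘ filter-↭ (e ≟ᴱ_)

  multiplicity-++ : ∀ e xs ys → multiplicity e (xs ++ ys) ≡ multiplicity e xs + multiplicity e ys
  multiplicity-++ e xs ys = trans (cong length (filter-++ (e ≟ᴱ_) xs ys)) (length-++ (filter (e ≟ᴱ_) xs))

  multiplicity-∉ : ∀ {e xs} → e ∉ xs → multiplicity e xs ≡ 0
  multiplicity-∉ {e} e∉xs = cong length
    (filter-none (e ≟ᴱ_) (All.tabulate λ x∈xs e≡x → e∉xs (subst (_∈ _) (sym e≡x) x∈xs)))

  length-filter-≐ : ∀ {P Q : Edge → Set} (P? : Decidable P) (Q? : Decidable Q) xs →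
                    (∀ {e} → e ∈ xs → P e ⇔ Q e) → length (filter P? xs) ≡ length (filter Q? xs)
  length-filter-≐ P? Q? []       P⇔Q = refl
  length-filter-≐ P? Q? (x ∷ xs) P⇔Q with P? x | Q? x
  ... | yes _ | yes _ = cong suc (length-filter-≐ P? Q? xs (P⇔Q ∘ there))
  ... | no _  | no _  = length-filter-≐ P? Q? xs (P⇔Q ∘ there)
  ... | yes p | no ¬q = contradiction (Equivalence.to (P⇔Q (here refl)) p) ¬q
  ... | no ¬p | yes q = contradiction (Equivalence.from (P⇔Q (here refl)) q) ¬p

  filter-local : ∀ {f g : Edge → ℕ} xs → (∀ {e} → e ∈ xs → f e ≡ g e) →
                 length (filter (λ e → f e ℕ.≟ 1) xs) ≡ length (filter (λ e → g e ℕ.≟ 1) xs)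
  filter-local xs eq = length-filter-≐ _ _ xs
    (λ e∈xs → mk⇔ (trans (sym (eq e∈xs))) (trans (eq e∈xs)))

  once-↭ : ∀ {xs ys} → xs ↭ ys → once xs ≡ once ys
  once-↭ {xs} {ys} p = trans
    (filter-local xs (λ {e} _ → multiplicity-↭ e p))
    (↭-length (filter-↭ (λ e → multiplicity e ys ℕ.≟ 1) p))

  -- An edge of one list has multiplicity 0 in the other, so the two counts do not interact.
  once-++ : ∀ xs ys → Disjoint xs ys → once (xs ++ ys) ≡ once xs + once ys
  once-++ xs ys disj = begin
    length (filter P? (xs ++ ys))                  ≡⟨ cong length (filter-++ P? xs ys) ⟩
    length (filter P? xs ++ filter P? ys)          ≡⟨ length-++ (filter P? xs) ⟩
    length (filter P? xs) + length (filter P? ys)  ≡⟨ cong₂ _+_ (filter-local xs onˡ) (filter-local ys onʳ) ⟩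
    once xs + once ys                              ∎
    where
    P? = λ e → multiplicity e (xs ++ ys) ℕ.≟ 1
    onˡ : ∀ {e} → e ∈ xs → multiplicity e (xs ++ ys) ≡ multiplicity e xs
    onˡ {e} e∈xs = trans (multiplicity-++ e xs ys)
      (trans (cong (multiplicity e xs +_) (multiplicity-∉ λ e∈ys → disj (e∈xs , e∈ys))) (ℕ.+-identityʳ _))
    onʳ : ∀ {e} → e ∈ ys → multiplicity e (xs ++ ys) ≡ multiplicity e ys
    onʳ {e} e∈ys = trans (multiplicity-++ e xs ys)
      (cong (_+ multiplicity e ys) (multiplicity-∉ λ e∈xs → disj (e∈xs , e∈ys)))

  once-single : ∀ e → once (e ∷ []) ≡ 1
  once-single e = cong length (filter-all (λ e′ → multiplicity e′ (e ∷ []) ℕ.≟ 1) {e ∷ []}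
    (cong length (filter-all (e ≟ᴱ_) {e ∷ []} (refl ∷ [])) ∷ []))

  once-double : ∀ e → once (e ∷ e ∷ []) ≡ 0
  once-double e = cong length (filter-none (λ e′ → multiplicity e′ (e ∷ e ∷ []) ℕ.≟ 1) {e ∷ e ∷ []} (twice ∷ twice ∷ []))
    where
    twice : multiplicity e (e ∷ e ∷ []) ≢ 1
    twice eq with () ← trans (sym (cong length (filter-all (e ≟ᴱ_) {e ∷ e ∷ []} (refl ∷ refl ∷ [])))) eq

  once-fresh : ∀ e xs → e ∉ xs → once (e ∷ xs) ≡ suc (once xs)
  once-fresh e xs e∉xs = trans
    (once-++ (e ∷ []) xs λ { (here refl , e∈xs) → e∉xs e∈xs })
    (cong (_+ once xs) (once-single e))

  -- A side shared by two cells is interior and drops out of the boundary.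
  once-pair : ∀ e xs → e ∉ xs → once (e ∷ e ∷ xs) ≡ once xs
  once-pair e xs e∉xs = trans
    (once-++ (e ∷ e ∷ []) xs λ { (here refl , e∈xs) → e∉xs e∈xs ; (there (here refl) , e∈xs) → e∉xs e∈xs })
    (cong (_+ once xs) (once-double e))

  separated : ∀ {P : Edge → Set} {xs ys} → All P xs → All (¬_ ∘ P) ys → Disjoint xs ys
  separated pxs ¬pys (e∈xs , e∈ys) = All.lookup ¬pys e∈ys (All.lookup pxs e∈xs)

  -- Used both for the cells of a column and for a run of vertical edges. The starting row moves in
  -- the recursion, so that induction removes the lowest entry.
  segment : ℕ → ℕ → ℕ → List (ℕ × ℕ)
  segment c s zero    = []
  segment c s (suc h) = (c , s) ∷ segment c (suc s) h

  applyUpTo-segment : ∀ {f : ℕ → ℕ × ℕ} c s h → (∀ k → f k ≡ (c , s + k)) → applyUpTo f h ≡ segment c s h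
  applyUpTo-segment c s zero    eq = refl
  applyUpTo-segment c s (suc h) eq = cong₂ _∷_
    (trans (eq 0) (cong (c ,_) (ℕ.+-identityʳ s)))
    (applyUpTo-segment c (suc s) h (λ k → trans (eq (suc k)) (cong (c ,_) (ℕ.+-suc s k))))

  column-segment : ∀ c s h → map (λ k → c , s + k) (upTo h) ≡ segment c s h
  column-segment c s h = trans (map-upTo (λ k → c , s + k) h) (applyUpTo-segment c s h (λ _ → refl))

  segment-column : ∀ c s h → All (λ e → proj₁ e ≡ c) (segment c s h)
  segment-column c s zero    = []
  segment-column c s (suc h) = refl ∷ segment-column c (suc s) h

  segment-above : ∀ c s h → All (λ e → s ≤ proj₂ e) (segment c s h)
  segment-above c s zero    = []
  segment-above c s (suc h) = ℕ.≤-refl ∷ All.map ℕ.<⇒≤ (segment-above c (suc s) h)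

  below-∉ : ∀ {c s : ℕ} {xs : List Edge} → All (λ e → s < proj₂ e) xs → (c , s) ∉ xs
  below-∉ above e∈xs = ℕ.<-irrefl refl (All.lookup above e∈xs)

  once-segment : ∀ c s h → once (segment c s h) ≡ h
  once-segment c s zero    = refl
  once-segment c s (suc h) = trans
    (once-fresh (c , s) _ (below-∉ (segment-above c (suc s) h)))
    (cong suc (once-segment c (suc s) h))

  -- The two runs start in the same row, so their entries cancel in pairs from below until the
  -- shorter run is exhausted.
  once-segments : ∀ c s m n → once (segment c s m ++ segment c s n) ≡ ∣ m - n ∣
  once-segments c s zero    n       = once-segment c s n
  once-segments c s (suc m) zero    = trans
    (cong once (++-identityʳ (segment c s (suc m)))) (once-segment c s (suc m))
  once-segments c s (suc m) (suc n) = begin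
    once ((c , s) ∷ segment c (suc s) m ++ (c , s) ∷ segment c (suc s) n)
      ≡⟨ once-↭ (prep (c , s) (shift (c , s) (segment c (suc s) m) _)) ⟩
    once ((c , s) ∷ (c , s) ∷ segment c (suc s) m ++ segment c (suc s) n)
      ≡⟨ once-pair (c , s) _ (below-∉ (All.++⁺ (segment-above c (suc s) m) (segment-above c (suc s) n))) ⟩
    once (segment c (suc s) m ++ segment c (suc s) n)
      ≡⟨ once-segments c (suc s) m n ⟩
    ∣ m - n ∣ ∎

  cellsFrom-∷ : ∀ i h hs → cellsFrom i (h ∷ hs) ≡ segment i i h ++ cellsFrom (suc i) hs
  cellsFrom-∷ i h hs = cong (_++ cellsFrom (suc i) hs) (column-segment i i h)

  sides-∷ : ∀ (sides : Cell → List Edge) i h hs →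
            concatMap sides (cellsFrom i (h ∷ hs)) ≡
            concatMap sides (segment i i h) ++ concatMap sides (cellsFrom (suc i) hs)
  sides-∷ sides i h hs = trans
    (cong (concatMap sides) (cellsFrom-∷ i h hs))
    (concatMap-++ sides (segment i i h) (cellsFrom (suc i) hs))

  cells-column : ∀ i hs → All (λ c → i ≤ proj₁ c) (cellsFrom i hs)
  cells-column i []       = []
  cells-column i (h ∷ hs) rewrite cellsFrom-∷ i h hs = All.++⁺
    (All.map (ℕ.≤-reflexive ∘ sym) (segment-column i i h))
    (All.map ℕ.<⇒≤ (cells-column (suc i) hs))

  All-concatMap : ∀ {P Q : ℕ × ℕ → Set} {f : Cell → List Edge} → (∀ {c} → P c → All Q (f c)) →
                  ∀ {cs} → All P cs → All Q (concatMap f cs)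
  All-concatMap imp ps = All.concat⁺ (All.map⁺ (All.map imp ps))

  length-cells : ∀ i hs → length (cellsFrom i hs) ≡ sum hs
  length-cells i []       = refl
  length-cells i (h ∷ hs) = begin
    length (map _ (upTo h) ++ cellsFrom (suc i) hs)          ≡⟨ length-++ (map _ (upTo h)) ⟩
    length (map _ (upTo h)) + length (cellsFrom (suc i) hs)  ≡⟨ cong₂ _+_ (trans (length-map _ (upTo h)) (length-upTo h)) (length-cells (suc i) hs) ⟩
    h + sum hs                                               ∎

  area≡sum : ∀ P → area P ≡ sum (heights P)
  area≡sum P = length-cells 1 (heights P)

  -- Horizontal semiperimeter

  columnSides-above : ∀ c s h → All (λ e → s ≤ proj₂ e) (concatMap horizontalSides (segment c s h))
  columnSides-above c s h =
    All-concatMap (λ s≤ → s≤ ∷ ℕ.m≤n⇒m≤1+n s≤ ∷ []) (segment-above c s h)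

  -- The extra edge is the upper side of a cell just below. With it, every edge except the topmost
  -- one occurs twice.
  once-column-tail : ∀ c s h → once ((c , s) ∷ concatMap horizontalSides (segment c s h)) ≡ 1
  once-column-tail c s zero    = once-single (c , s)
  once-column-tail c s (suc h) = trans
    (once-pair (c , s) _ (below-∉ (ℕ.n<1+n s ∷ columnSides-above c (suc s) h)))
    (once-column-tail c (suc s) h)

  once-column : ∀ c s {h} → 1 ≤ h → once (concatMap horizontalSides (segment c s h)) ≡ 2
  once-column c s {suc h} _ = trans
    (once-fresh (c , s) _ (below-∉ (ℕ.n<1+n s ∷ columnSides-above c (suc s) h)))
    (cong suc (once-column-tail c (suc s) h))

  -- A horizontal edge keeps the column of its cell, so different columns share none, and each
  -- contributes its bottom and its top edge.
  once-horizontal : ∀ i {hs} → All (1 ≤_) hs → once (concatMap horizontalSides (cellsFrom i hs)) ≡ length hs + length hs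
  once-horizontal i []                        = refl
  once-horizontal i {h ∷ hs} (1≤h ∷ 1≤hs) = begin
    once (concatMap horizontalSides (cellsFrom i (h ∷ hs)))
      ≡⟨ cong once (sides-∷ horizontalSides i h hs) ⟩
    once (concatMap horizontalSides (segment i i h) ++ concatMap horizontalSides (cellsFrom (suc i) hs))
      ≡⟨ once-++ (concatMap horizontalSides (segment i i h)) _ (separated {P = λ e → proj₁ e ≡ i}
           (All-concatMap (λ c≡i → c≡i ∷ c≡i ∷ []) (segment-column i i h))
           (All-concatMap (λ i<c → ℕ.>⇒≢ i<c ∷ ℕ.>⇒≢ i<c ∷ []) (cells-column (suc i) hs))) ⟩
    once (concatMap horizontalSides (segment i i h)) + once (concatMap horizontalSides (cellsFrom (suc i) hs))
      ≡⟨ cong₂ _+_ (once-column i i 1≤h) (once-horizontal (suc i) 1≤hs) ⟩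
    2 + (length hs + length hs)
      ≡⟨ cong suc (ℕ.+-suc (length hs) (length hs)) ⟨
    suc (length hs) + suc (length hs) ∎

  ⌊n+n/2⌋≡n : ∀ n → ⌊ n + n /2⌋ ≡ n
  ⌊n+n/2⌋≡n n = sym (ℕ.n≡⌊n+n/2⌋ n)

  fibonacci-positive : ∀ {hs} → IsFibonacci hs → All (1 ≤_) hs
  fibonacci-positive (lastColumn 1≤h) = 1≤h ∷ []
  fibonacci-positive (2≤h ∷ fib)      = ℕ.<⇒≤ 2≤h ∷ fibonacci-positive fib

  xper≡length : ∀ P → xper P ≡ length (heights P)
  xper≡length (polyomino hs fib) = trans
    (cong ⌊_/2⌋ (once-horizontal 1 (fibonacci-positive fib))) (⌊n+n/2⌋≡n (length hs))

  -- Vertical semiperimeter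

  verticalSides-segment : ∀ c s h → concatMap verticalSides (segment c s h) ↭ segment c s h ++ segment (suc c) s h
  verticalSides-segment c s zero    = ↭-refl
  verticalSides-segment c s (suc h) = prep (c , s) (↭-trans
    (prep (suc c , s) (verticalSides-segment c (suc s) h))
    (↭-sym (shift (suc c , s) (segment c (suc s) h) (segment (suc c) (suc s) h))))

  vertical : ℕ → List ℕ → List Edge
  vertical i hs = concatMap verticalSides (cellsFrom i hs)

  -- Left and right edges are separated because they behave differently: the left ones meet no later
  -- column, while the right ones lie where the next column has its left edges.
  vertical-∷ : ∀ i h hs → vertical i (h ∷ hs) ↭ segment i i h ++ (segment (suc i) i h ++ vertical (suc i) hs)
  vertical-∷ i h hs = ↭-trans
    (↭-reflexive (sides-∷ verticalSides i h hs))
    (↭-trans (++⁺ʳ (vertical (suc i) hs) (verticalSides-segment i i h))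
             (↭-reflexive (++-assoc (segment i i h) (segment (suc i) i h) _)))

  vertical-column : ∀ i hs → All (λ e → i ≤ proj₁ e) (vertical i hs)
  vertical-column i hs =
    All-concatMap (λ i≤c → i≤c ∷ ℕ.m≤n⇒m≤1+n i≤c ∷ []) (cells-column i hs)

  columnʳ : ∀ {i j} s h → i < j → All (λ e → i < proj₁ e) (segment j s h)
  columnʳ {i} {j} s h i<j = All.map (λ eq → subst (i <_) (sym eq) i<j) (segment-column j s h)

  once-vertical-∷ : ∀ i h hs → once (vertical i (h ∷ hs)) ≡ h + once (segment (suc i) i h ++ vertical (suc i) hs)
  once-vertical-∷ i h hs = begin
    once (vertical i (h ∷ hs))
      ≡⟨ once-↭ (vertical-∷ i h hs) ⟩
    once (segment i i h ++ (segment (suc i) i h ++ vertical (suc i) hs))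
      ≡⟨ once-++ (segment i i h) _ (separated {P = λ e → proj₁ e ≡ i}
           (segment-column i i h)
           (All.map ℕ.>⇒≢ (All.++⁺ (columnʳ i h (ℕ.n<1+n i)) (vertical-column (suc i) hs)))) ⟩
    once (segment i i h) + once (segment (suc i) i h ++ vertical (suc i) hs)
      ≡⟨ cong (_+ once (segment (suc i) i h ++ vertical (suc i) hs)) (once-segment i i h) ⟩
    h + once (segment (suc i) i h ++ vertical (suc i) hs) ∎

  -- The next column starts one row higher, so the lowest right edge is never shared; above it two
  -- runs starting in the same row cancel.
  once-interface : ∀ c s g h → once (segment c s (suc g) ++ segment c (suc s) h) ≡ suc ∣ g - h ∣
  once-interface c s g h = trans
    (once-fresh (c , s) _ (below-∉ (All.++⁺ (segment-above c (suc s) g) (segment-above c (suc s) h))))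
    (cong suc (once-segments c (suc s) g h))

  -- Equal to max (h - h′) 1.
  overhang : ℕ → ℕ → ℕ
  overhang h h′ = suc ((h ∸ 1) ∸ h′)

  ySemi : List ℕ → ℕ
  ySemi []            = 0
  ySemi (h ∷ [])      = h
  ySemi (h ∷ h′ ∷ hs) = overhang h h′ + ySemi (h′ ∷ hs)

  -- Trades the symmetric difference found at an interface for the one-sided `m ∸ n` of `overhang`.
  ∣m-n∣+m : ∀ m n → ∣ m - n ∣ + m ≡ (m ∸ n) + (m ∸ n) + n
  ∣m-n∣+m zero    zero    = refl
  ∣m-n∣+m zero    (suc n) = ℕ.+-identityʳ (suc n)
  ∣m-n∣+m (suc m) zero    = sym (ℕ.+-identityʳ _)
  ∣m-n∣+m (suc m) (suc n) = trans (ℕ.+-suc ∣ m - n ∣ m)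
    (trans (cong suc (∣m-n∣+m m n)) (sym (ℕ.+-suc _ n)))

  -- The summand `h` stands for the left edges of the first column and completes the vertical
  -- boundary. They are kept out of the list because in the induction those of the next column are
  -- consumed at the interface with its predecessor.
  once-right : ∀ i h hs → All (1 ≤_) (h ∷ hs) →
               once (segment (suc i) i h ++ vertical (suc i) hs) + h ≡ ySemi (h ∷ hs) + ySemi (h ∷ hs)
  once-right i h [] _ = cong (_+ h) (trans
    (cong once (++-identityʳ (segment (suc i) i h))) (once-segment (suc i) i h))
  once-right i (suc g) (h ∷ hs) (_ ∷ 1≤hs) = begin
    once (segment (suc i) i (suc g) ++ vertical (suc i) (h ∷ hs)) + suc g
      -- The left edges `L` of the next column are brought next to the right edges `R`, the only
      -- ones that they can cancel with.
      ≡⟨ cong (_+ suc g) (once-↭ (↭-trans (++⁺ˡ R (vertical-∷ (suc i) h hs)) (↭-reflexive (sym (++-assoc R L rest))))) ⟩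
    once ((R ++ L) ++ rest) + suc g
      ≡⟨ cong (_+ suc g) (once-++ (R ++ L) rest (separated {P = λ e → proj₁ e ≡ suc i}
           (All.++⁺ (segment-column (suc i) i (suc g)) (segment-column (suc i) (suc i) h))
           (All.map ℕ.>⇒≢ (All.++⁺ (columnʳ (suc i) h (ℕ.n<1+n (suc i))) (vertical-column (suc (suc i)) hs))))) ⟩
    once (R ++ L) + once rest + suc g
      ≡⟨ cong (λ z → z + once rest + suc g) (once-interface (suc i) i g h) ⟩
    suc ∣ g - h ∣ + once rest + suc g
      ≡⟨ solve 3 (λ d r g → con 1 :+ d :+ r :+ (con 1 :+ g) := con 2 :+ (d :+ g :+ r)) refl ∣ g - h ∣ (once rest) g ⟩
    2 + (∣ g - h ∣ + g + once rest)
      ≡⟨ cong (λ z → 2 + (z + once rest)) (∣m-n∣+m g h) ⟩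
    2 + ((g ∸ h) + (g ∸ h) + h + once rest)
      ≡⟨ solve 3 (λ m h r → con 2 :+ (m :+ m :+ h :+ r) := con 2 :+ (m :+ m :+ (r :+ h))) refl (g ∸ h) h (once rest) ⟩
    2 + ((g ∸ h) + (g ∸ h) + (once rest + h))
      ≡⟨ cong (λ z → 2 + ((g ∸ h) + (g ∸ h) + z)) (once-right (suc i) h hs 1≤hs) ⟩
    2 + ((g ∸ h) + (g ∸ h) + (y + y))
      ≡⟨ solve 2 (λ m y → con 2 :+ (m :+ m :+ (y :+ y)) := con 1 :+ m :+ y :+ (con 1 :+ m :+ y)) refl (g ∸ h) y ⟩
    overhang (suc g) h + y + (overhang (suc g) h + y) ∎
    where
    open +-*-Solver
    R = segment (suc i) i (suc g)
    L = segment (suc i) (suc i) h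
    rest = segment (suc (suc i)) (suc i) h ++ vertical (suc (suc i)) hs
    y = ySemi (h ∷ hs)

  yper≡ySemi : ∀ P → yper P ≡ ySemi (heights P)
  yper≡ySemi (polyomino (h ∷ hs) fib) = trans
    (cong ⌊_/2⌋ (trans (once-vertical-∷ 1 h hs) (trans (ℕ.+-comm h _) (once-right 1 h hs (fibonacci-positive fib)))))
    (⌊n+n/2⌋≡n (ySemi (h ∷ hs)))

-- Enumeration by the height of the first column

module Enumeration where

  open import Data.Fin.Base using (Fin; zero; suc)
  open import Data.List.Base using (List; []; _∷_; map; concatMap; upTo; length; lookup)
  open import Data.List.Membership.Propositional using (_∈_; find; lose)
  open import Data.List.Membership.Propositional.Properties using (∈-map⁺; ∈-map⁻; ∈-concatMap⁺; ∈-concatMap⁻; ∈-upTo⁺; ∈-lookup)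
  open import Data.List.Properties using (∷-injectiveʳ)
  import Data.List.Relation.Unary.AllPairs.Properties as AllPairs
  open import Data.List.Relation.Unary.All as All using ([]; _∷_)
  import Data.List.Relation.Unary.All.Properties as All
  open import Data.List.Relation.Unary.AllPairs using ([]; _∷_)
  open import Data.List.Relation.Unary.Any as Any using (here)
  open import Data.List.Relation.Unary.Any.Properties using (lookup-index)
  open import Data.List.Relation.Unary.Unique.Propositional using (Unique)
  import Data.List.Relation.Unary.Unique.Propositional.Properties as Unique
  open import Data.Nat.Base using (_+_)
  open import Data.Nat.ListAction using (sum)
  open import Function.Bundles using (_↔_; mk↔ₛ′)
  open import Relation.Nullary using (contradiction)
  open Defs using (FibonacciPolyomino; polyomino; IsFibonacci; lastColumn; _∷_; xper; yper; area; heights; isFibonacci)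
  open Boundary

  -- Multiplication by the `p`-th power of a variable. It is polymorphic so that lists of
  -- polyominoes and integer coefficients are shifted by one and the same operation.
  delay : ∀ {A : Set} → A → ℕ → (ℕ → A) → ℕ → A
  delay d zero    g n       = g n
  delay d (suc p) g zero    = d
  delay d (suc p) g (suc n) = delay d p g n

  module _ {A : Set} where

    ∈-delay⁺ : ∀ {x : A} p (g : ℕ → List A) {m} → x ∈ g m → x ∈ delay [] p g (p + m)
    ∈-delay⁺ zero    g x∈ = x∈
    ∈-delay⁺ (suc p) g x∈ = ∈-delay⁺ p g x∈

    ∈-delay⁻ : ∀ {x : A} p (g : ℕ → List A) n → x ∈ delay [] p g n → ∃[ m ] n ≡ p + m × x ∈ g m
    ∈-delay⁻ zero    g n       x∈ = n , refl , x∈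
    ∈-delay⁻ (suc p) g (suc n) x∈ with m , refl , x∈gm ← ∈-delay⁻ p g n x∈ = m , refl , x∈gm

    delay-unique : ∀ p {g : ℕ → List A} → (∀ m → Unique (g m)) → ∀ n → Unique (delay [] p g n)
    delay-unique zero    u n       = u n
    delay-unique (suc p) u zero    = []
    delay-unique (suc p) u (suc n) = delay-unique p u n

    concatMap-unique : ∀ {f : ℕ → List A} → (∀ j → Unique (f j)) →
                       (∀ {i j x} → x ∈ f i → x ∈ f j → i ≡ j) → ∀ n → Unique (concatMap f (upTo n))
    concatMap-unique {f} u inj n = Unique.concat⁺
      (All.map⁺ (All.universal u (upTo n)))
      (AllPairs.map⁺ (AllPairs.applyUpTo⁺₁ id n λ i<j _ (x∈fi , x∈fj) → ℕ.<⇒≢ i<j (inj x∈fi x∈fj)))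

    lookup-injective : ∀ {xs : List A} → Unique xs → ∀ {i j} → lookup xs i ≡ lookup xs j → i ≡ j
    lookup-injective (_ ∷ _) {zero}  {zero}  _  = refl
    lookup-injective (x∉ ∷ _) {zero}  {suc j} eq = contradiction eq (All.lookup x∉ (∈-lookup j))
    lookup-injective (x∉ ∷ _) {suc i} {zero}  eq = contradiction (sym eq) (All.lookup x∉ (∈-lookup i))
    lookup-injective (_ ∷ u) {suc i} {suc j} eq = cong suc (lookup-injective u eq)

  -- firstColumn k a b n lists the height sequences of the Fibonacci polyominoes
  -- with first column of height k + 1, a columns, vertical semiperimeter b and
  -- area n; afterFirst k a b n is the same list indexed by the number a and the
  -- total area n of the columns after the first.  The range of j is that of ∑∞.
  firstColumn afterFirst : ℕ → ℕ → ℕ → ℕ → List (List ℕ)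

  -- Nonempty only in degree 0, like the series 1; the delay by `suc k` in `afterFirst` makes it the
  -- list counterpart of `Y ^ suc k`.
  onlyColumn : ℕ → ℕ → List (List ℕ)
  onlyColumn k zero    = (suc k ∷ []) ∷ []
  onlyColumn k (suc b) = []

  -- Here the first two columns have heights `suc (suc k)` and `suc j`, and the shift `suc (k ∸ j)`
  -- is their `overhang`.
  secondColumn : ℕ → ℕ → ℕ → ℕ → ℕ → List (List ℕ)

  firstColumn k zero    b n = []
  firstColumn k (suc a) b n = delay [] (suc k) (afterFirst k a b) n

  afterFirst k       zero    b (suc n) = []
  afterFirst k       zero    b zero    = delay [] (suc k) (onlyColumn k) b
  afterFirst zero    (suc a) b n       = []
  afterFirst (suc k) (suc a) b n       =
    map (suc (suc k) ∷_) (concatMap (secondColumn k (suc a) b n) (upTo (suc (suc a + b + n))))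

  secondColumn k a b n j = delay [] (suc (k ∸ j)) (λ b′ → firstColumn j a b′ n) b

  Describes : ℕ → ℕ → ℕ → List ℕ → Set
  Describes a b n hs = IsFibonacci hs × length hs ≡ a × ySemi hs ≡ b × sum hs ≡ n

  -- The shape `suc k ∷ hs` is part of the claim because the recursion needs it to evaluate the
  -- overhang, and because it makes the lists for different `k` disjoint.
  firstColumn-sound : ∀ k a b n {x} → x ∈ firstColumn k a b n → ∃[ hs ] x ≡ suc k ∷ hs × Describes a b n x
  firstColumn-sound k (suc a) b n x∈ with ∈-delay⁻ (suc k) (afterFirst k a b) n x∈
  firstColumn-sound k (suc zero) b n x∈ | zero , refl , x∈′
    with zero , refl , here refl ← ∈-delay⁻ (suc k) (onlyColumn k) b x∈′ =
    [] , refl , lastColumn (s≤s z≤n) , refl , sym (ℕ.+-identityʳ _) , refl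
  firstColumn-sound (suc k) (suc (suc a)) b n x∈ | n′ , refl , x∈′
    with ys , ys∈ , refl ← ∈-map⁻ (suc (suc k) ∷_) x∈′
    with j , _ , ys∈′ ← find (∈-concatMap⁻ (secondColumn k (suc a) b n′) {upTo (suc (suc a + b + n′))} ys∈)
    with b′ , refl , ys∈″ ← ∈-delay⁻ (suc (k ∸ j)) (λ b′ → firstColumn j (suc a) b′ n′) b ys∈′
    with hs , refl , fib , refl , refl , refl ← firstColumn-sound j (suc a) b′ n′ ys∈″ =
    ys , refl , s≤s (s≤s z≤n) ∷ fib , refl , refl , refl

  firstColumn-complete : ∀ k hs → IsFibonacci (suc k ∷ hs) →
                         suc k ∷ hs ∈ firstColumn k (suc (length hs)) (ySemi (suc k ∷ hs)) (suc k + sum hs)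
  firstColumn-complete k [] _ = ∈-delay⁺ (suc k) (afterFirst k 0 (suc k))
    (subst (λ b → suc k ∷ [] ∈ delay [] (suc k) (onlyColumn k) b) (ℕ.+-identityʳ (suc k))
      (∈-delay⁺ (suc k) (onlyColumn k) (here refl)))
  firstColumn-complete k (zero ∷ hs) (_ ∷ fib) with () ∷ _ ← fibonacci-positive fib
  firstColumn-complete (suc k) (suc j ∷ hs) (_ ∷ fib) =
    ∈-delay⁺ (suc (suc k)) (afterFirst (suc k) (suc (length hs)) b)
      (∈-map⁺ (suc (suc k) ∷_) (∈-concatMap⁺ (secondColumn k (suc (length hs)) b n)
        -- The cut-off loses nothing: the second column is part of the remaining area, so `j ≤ n`.
        (lose (∈-upTo⁺ (s≤s (ℕ.≤-trans j≤n (ℕ.m≤n+m n (suc (length hs) + b)))))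
          (∈-delay⁺ (suc (k ∸ j)) (λ b → firstColumn j (suc (length hs)) b n)
            (firstColumn-complete j hs fib)))))
    where
    n = suc j + sum hs
    b = ySemi (suc (suc k) ∷ suc j ∷ hs)
    j≤n : j ≤ n
    j≤n = ℕ.≤-trans (ℕ.n≤1+n j) (ℕ.m≤m+n (suc j) (sum hs))
  firstColumn-complete zero (suc j ∷ hs) (s≤s () ∷ fib)

  firstColumn-disjoint : ∀ a b b′ n {i j x} → x ∈ firstColumn i a b n → x ∈ firstColumn j a b′ n → i ≡ j
  firstColumn-disjoint a b b′ n {i} {j} x∈i x∈j
    with _ , refl , _ ← firstColumn-sound i a b n x∈i
    with _ , refl , _ ← firstColumn-sound j a b′ n x∈j = refl

  onlyColumn-unique : ∀ k b → Unique (onlyColumn k b)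
  onlyColumn-unique k zero    = [] ∷ []
  onlyColumn-unique k (suc b) = []

  firstColumn-unique : ∀ k a b n → Unique (firstColumn k a b n)
  afterFirst-unique  : ∀ k a b n → Unique (afterFirst k a b n)

  firstColumn-unique k zero    b n = []
  firstColumn-unique k (suc a) b n = delay-unique (suc k) (afterFirst-unique k a b) n

  afterFirst-unique k       zero    b (suc n) = []
  afterFirst-unique k       zero    b zero    = delay-unique (suc k) (onlyColumn-unique k) b
  afterFirst-unique zero    (suc a) b n       = []
  afterFirst-unique (suc k) (suc a) b n       = Unique.map⁺ ∷-injectiveʳ
    (concatMap-unique (λ j → delay-unique (suc (k ∸ j)) (λ b′ → firstColumn-unique j (suc a) b′ n) b)
      disjoint (suc (suc a + b + n)))
    where
    disjoint : ∀ {i j x} → x ∈ secondColumn k (suc a) b n i → x ∈ secondColumn k (suc a) b n j → i ≡ j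
    disjoint {i} {j} x∈i x∈j
      with bᵢ , _ , x∈i′ ← ∈-delay⁻ (suc (k ∸ i)) (λ b′ → firstColumn i (suc a) b′ n) b x∈i
      with bⱼ , _ , x∈j′ ← ∈-delay⁻ (suc (k ∸ j)) (λ b′ → firstColumn j (suc a) b′ n) b x∈j
      = firstColumn-disjoint (suc a) bᵢ bⱼ n x∈i′ x∈j′

  -- The cut-off is that of `∑∞`, so that the length is a coefficient of `∑∞ H`; it suffices because
  -- the first column alone has area `suc k`.
  heightLists : ℕ → ℕ → ℕ → List (List ℕ)
  heightLists a b n = concatMap (λ k → firstColumn k a b n) (upTo (suc (a + b + n)))

  heightLists-unique : ∀ a b n → Unique (heightLists a b n)
  heightLists-unique a b n = concatMap-unique (λ k → firstColumn-unique k a b n)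
    (firstColumn-disjoint a b b n) (suc (a + b + n))

  heightLists-sound : ∀ a b n {x} → x ∈ heightLists a b n → Describes a b n x
  heightLists-sound a b n x∈
    with k , _ , x∈k ← find (∈-concatMap⁻ (λ k → firstColumn k a b n) {upTo (suc (a + b + n))} x∈)
    with _ , _ , d ← firstColumn-sound k a b n x∈k = d

  heightLists-complete : ∀ {a b n x} → Describes a b n x → x ∈ heightLists a b n
  heightLists-complete {x = zero ∷ hs} (fib , _) with () ∷ _ ← fibonacci-positive fib
  heightLists-complete {x = suc k ∷ hs} (fib , refl , refl , refl) =
    ∈-concatMap⁺ (λ k → firstColumn k (suc (length hs)) b n)
      (lose (∈-upTo⁺ (s≤s (ℕ.≤-trans k≤n (ℕ.m≤n+m n (suc (length hs) + b)))))
        (firstColumn-complete k hs fib))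
    where
    b = ySemi (suc k ∷ hs)
    n = suc k + sum hs
    k≤n : k ≤ n
    k≤n = ℕ.≤-trans (ℕ.n≤1+n k) (ℕ.m≤m+n (suc k) (sum hs))

  -- Reduces equality of polyominoes to equality of heights, so that a duplicate-free list of height
  -- sequences yields a bijection.
  IsFibonacci-irrelevant : ∀ {hs} (p q : IsFibonacci hs) → p ≡ q
  IsFibonacci-irrelevant (lastColumn p) (lastColumn q) = cong lastColumn (ℕ.≤-irrelevant p q)
  IsFibonacci-irrelevant (lastColumn p) (q ∷ ())
  IsFibonacci-irrelevant (p ∷ ()) (lastColumn q)
  IsFibonacci-irrelevant (p ∷ ps) (q ∷ qs) = cong₂ _∷_ (ℕ.≤-irrelevant p q) (IsFibonacci-irrelevant ps qs)

  polyominoes : ∀ a b n → Fin (length (heightLists a b n)) ↔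
                (Σ[ P ∈ FibonacciPolyomino ] xper P ≡ a × yper P ≡ b × area P ≡ n)
  polyominoes a b n = mk↔ₛ′ to from to∘from from∘to
    where
    Counted = Σ[ P ∈ FibonacciPolyomino ] xper P ≡ a × yper P ≡ b × area P ≡ n
    L = heightLists a b n

    to : Fin (length L) → Counted
    to i with fib , l , y , s ← heightLists-sound a b n (∈-lookup {xs = L} i) =
      P , trans (xper≡length P) l , trans (yper≡ySemi P) y , trans (area≡sum P) s
      where P = polyomino (lookup L i) fib

    listed : ((P , _) : Counted) → heights P ∈ L
    listed (P , l , y , s) = heightLists-complete
      (isFibonacci P , trans (sym (xper≡length P)) l , trans (sym (yper≡ySemi P)) y , trans (sym (area≡sum P)) s)

    from : Counted → Fin (length L)
    from c = Any.index (listed c)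

    counted-≡ : ∀ (c d : Counted) → heights (proj₁ c) ≡ heights (proj₁ d) → c ≡ d
    counted-≡ (polyomino hs p , l , y , s) (polyomino hs q , l′ , y′ , s′) refl
      rewrite IsFibonacci-irrelevant p q | ℕ.≡-irrelevant l l′ | ℕ.≡-irrelevant y y′ | ℕ.≡-irrelevant s s′ = refl

    to∘from : ∀ c → to (from c) ≡ c
    to∘from c = counted-≡ _ _ (sym (lookup-index (listed c)))

    from∘to : ∀ i → from (to i) ≡ i
    from∘to i = lookup-injective (heightLists-unique a b n) (sym (lookup-index (listed (to i))))

-- The ring of formal power series

module PowerSeries {c ℓ} (R : CommutativeRing c ℓ) where

  private module R = CommutativeRing R
  open R using (Carrier; _≈_)
  open SetoidReasoning R.setoid
  open CommutativeSemigroupProperties R.+-commutativeSemigroup using (interchange)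

  infix  4 _≋_
  infixl 6 _⊕_
  infixl 7 _⊛_ _·_

  Ser : Set c
  Ser = ℕ → Carrier

  _≋_ : Ser → Ser → Set ℓ
  f ≋ g = ∀ n → f n ≈ g n

  sum : ℕ → Ser → Carrier
  sum zero    t = R.0#
  sum (suc n) t = sum n t R.+ t n

  sum-cong : ∀ n {t t′} → (∀ i → i ℕ.< n → t i ≈ t′ i) → sum n t ≈ sum n t′
  sum-cong zero    eq = R.refl
  sum-cong (suc n) eq = R.+-cong (sum-cong n (λ i i<n → eq i (ℕ.m<n⇒m<1+n i<n))) (eq n (ℕ.n<1+n n))

  sum-+ : ∀ n t t′ → sum n (λ i → t i R.+ t′ i) ≈ sum n t R.+ sum n t′
  sum-+ zero    t t′ = R.sym (R.+-identityʳ R.0#)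
  sum-+ (suc n) t t′ = R.trans (R.+-congʳ (sum-+ n t t′)) (interchange _ _ _ _)

  sum-zero : ∀ n → sum n (λ _ → R.0#) ≈ R.0#
  sum-zero zero    = R.refl
  sum-zero (suc n) = R.trans (R.+-congʳ (sum-zero n)) (R.+-identityʳ R.0#)

  sum-*ˡ : ∀ n x t → sum n (λ i → x R.* t i) ≈ x R.* sum n t
  sum-*ˡ zero    x t = R.sym (R.zeroʳ x)
  sum-*ˡ (suc n) x t = R.trans (R.+-congʳ (sum-*ˡ n x t)) (R.sym (R.distribˡ x _ _))

  sum-head : ∀ n t → sum (suc n) t ≈ t 0 R.+ sum n (t ∘ suc)
  sum-head zero    t = R.+-comm R.0# (t 0)
  sum-head (suc n) t = R.trans (R.+-congʳ (sum-head n t)) (R.+-assoc (t 0) _ _)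

  _⊕_ _⊛_ : Ser → Ser → Ser
  (f ⊕ g) n = f n R.+ g n
  (f ⊛ g) n = sum (suc n) (λ i → f i R.* g (n ∸ i))

  ⊝_ : Ser → Ser
  (⊝ f) n = R.- f n

  _·_ : Carrier → Ser → Ser
  (x · f) n = x R.* f n

  0ˢ 1ˢ : Ser
  0ˢ _ = R.0#
  1ˢ zero    = R.1#
  1ˢ (suc _) = R.0#

  ⊛-cong : ∀ {f f′ g g′} → f ≋ f′ → g ≋ g′ → f ⊛ g ≋ f′ ⊛ g′
  ⊛-cong f≋ g≋ n = sum-cong (suc n) (λ i _ → R.*-cong (f≋ i) (g≋ (n ∸ i)))

  ⊛-zero : ∀ f g → (f ⊛ g) 0 ≈ f 0 R.* g 0
  ⊛-zero f g = R.+-identityˡ _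

  -- Together with `⊛-sucʳ`, which splits off the other end, this gives the product by recursion on
  -- the index; commutativity and associativity then follow by induction, without reindexing a
  -- double sum.
  ⊛-suc : ∀ f g n → (f ⊛ g) (suc n) ≈ f 0 R.* g (suc n) R.+ ((f ∘ suc) ⊛ g) n
  ⊛-suc f g n = sum-head (suc n) (λ i → f i R.* g (suc n ∸ i))

  ⊛-sucʳ : ∀ f g n → (f ⊛ g) (suc n) ≈ (f ⊛ (g ∘ suc)) n R.+ f (suc n) R.* g 0
  ⊛-sucʳ f g n = R.+-cong
    (sum-cong (suc n) (λ i i≤n → R.*-congˡ (R.reflexive (≡.cong g (ℕ.+-∸-assoc 1 (ℕ.≤-pred i≤n))))))
    (R.*-congˡ (R.reflexive (≡.cong g (ℕ.n∸n≡0 n))))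

  ⊛-comm : ∀ f g → f ⊛ g ≋ g ⊛ f
  ⊛-comm f g zero    = R.+-congˡ (R.*-comm (f 0) (g 0))
  ⊛-comm f g (suc n) = begin
    (f ⊛ g) (suc n)                              ≈⟨ ⊛-suc f g n ⟩
    f 0 R.* g (suc n) R.+ ((f ∘ suc) ⊛ g) n      ≈⟨ R.+-cong (R.*-comm _ _) (⊛-comm (f ∘ suc) g n) ⟩
    g (suc n) R.* f 0 R.+ (g ⊛ (f ∘ suc)) n      ≈⟨ R.+-comm _ _ ⟩
    (g ⊛ (f ∘ suc)) n R.+ g (suc n) R.* f 0      ≈⟨ ⊛-sucʳ g f n ⟨
    (g ⊛ f) (suc n)                              ∎

  ⊛-distribʳ : ∀ h f g → (f ⊕ g) ⊛ h ≋ (f ⊛ h) ⊕ (g ⊛ h)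
  ⊛-distribʳ h f g n = R.trans
    (sum-cong (suc n) (λ i _ → R.distribʳ (h (n ∸ i)) (f i) (g i)))
    (sum-+ (suc n) _ _)

  ⊛-distribˡ : ∀ h f g → h ⊛ (f ⊕ g) ≋ (h ⊛ f) ⊕ (h ⊛ g)
  ⊛-distribˡ h f g n = R.trans
    (sum-cong (suc n) (λ i _ → R.distribˡ (h i) (f (n ∸ i)) (g (n ∸ i))))
    (sum-+ (suc n) _ _)

  ·-⊛ : ∀ x f g → (x · f) ⊛ g ≋ x · (f ⊛ g)
  ·-⊛ x f g n = R.trans
    (sum-cong (suc n) (λ i _ → R.*-assoc x (f i) (g (n ∸ i))))
    (sum-*ˡ (suc n) x _)

  -- The tail of `f ⊛ g` is `(f 0 · (g ∘ suc)) ⊕ ((f ∘ suc) ⊛ g)`. Scalars pass through products,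
  -- and the induction hypothesis at the smaller index applies to the tail of `f`.
  ⊛-assoc : ∀ f g h → (f ⊛ g) ⊛ h ≋ f ⊛ (g ⊛ h)
  ⊛-assoc f g h zero = begin
    ((f ⊛ g) ⊛ h) 0              ≈⟨ ⊛-zero (f ⊛ g) h ⟩
    (f ⊛ g) 0 R.* h 0            ≈⟨ R.*-congʳ (⊛-zero f g) ⟩
    f 0 R.* g 0 R.* h 0          ≈⟨ R.*-assoc _ _ _ ⟩
    f 0 R.* (g 0 R.* h 0)        ≈⟨ R.*-congˡ (⊛-zero g h) ⟨
    f 0 R.* (g ⊛ h) 0            ≈⟨ ⊛-zero f (g ⊛ h) ⟨
    (f ⊛ (g ⊛ h)) 0              ∎
  ⊛-assoc f g h (suc n) = begin
    ((f ⊛ g) ⊛ h) (suc n)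
      ≈⟨ ⊛-suc (f ⊛ g) h n ⟩
    (f ⊛ g) 0 R.* h (suc n) R.+ (((f ⊛ g) ∘ suc) ⊛ h) n
      ≈⟨ R.+-cong (R.*-congʳ (⊛-zero f g)) (⊛-cong {g = h} (⊛-suc f g) (λ _ → R.refl) n) ⟩
    f 0 R.* g 0 R.* h (suc n) R.+ (((f 0 · (g ∘ suc)) ⊕ (f′ ⊛ g)) ⊛ h) n
      ≈⟨ R.+-cong (R.*-assoc _ _ _) (⊛-distribʳ h (f 0 · (g ∘ suc)) (f′ ⊛ g) n) ⟩
    f 0 R.* (g 0 R.* h (suc n)) R.+ (((f 0 · (g ∘ suc)) ⊛ h) n R.+ ((f′ ⊛ g) ⊛ h) n)
      ≈⟨ R.+-congˡ (R.+-cong (·-⊛ (f 0) (g ∘ suc) h n) (⊛-assoc f′ g h n)) ⟩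
    f 0 R.* (g 0 R.* h (suc n)) R.+ (f 0 R.* ((g ∘ suc) ⊛ h) n R.+ (f′ ⊛ (g ⊛ h)) n)
      ≈⟨ R.+-assoc _ _ _ ⟨
    f 0 R.* (g 0 R.* h (suc n)) R.+ f 0 R.* ((g ∘ suc) ⊛ h) n R.+ (f′ ⊛ (g ⊛ h)) n
      ≈⟨ R.+-congʳ (R.distribˡ (f 0) _ _) ⟨
    f 0 R.* (g 0 R.* h (suc n) R.+ ((g ∘ suc) ⊛ h) n) R.+ (f′ ⊛ (g ⊛ h)) n
      ≈⟨ R.+-congʳ (R.*-congˡ (⊛-suc g h n)) ⟨
    f 0 R.* (g ⊛ h) (suc n) R.+ (f′ ⊛ (g ⊛ h)) n
      ≈⟨ ⊛-suc f (g ⊛ h) n ⟨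
    (f ⊛ (g ⊛ h)) (suc n) ∎
    where f′ = f ∘ suc

  ⊛-identityˡ : ∀ f → 1ˢ ⊛ f ≋ f
  ⊛-identityˡ f n = begin
    (1ˢ ⊛ f) n                                    ≈⟨ sum-head n _ ⟩
    R.1# R.* f n R.+ sum n (λ i → R.0# R.* f (n ∸ suc i))
      ≈⟨ R.+-cong (R.*-identityˡ (f n)) (R.trans (sum-cong n (λ i _ → R.zeroˡ _)) (sum-zero n)) ⟩
    f n R.+ R.0#                                  ≈⟨ R.+-identityʳ (f n) ⟩
    f n                                           ∎

  𝕩 : Ser
  𝕩 zero    = R.0#
  𝕩 (suc n) = 1ˢ n

  𝕩⊛-zero : ∀ f → (𝕩 ⊛ f) 0 ≈ R.0#
  𝕩⊛-zero f = R.trans (⊛-zero 𝕩 f) (R.zeroˡ (f 0))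

  𝕩⊛-suc : ∀ f n → (𝕩 ⊛ f) (suc n) ≈ f n
  𝕩⊛-suc f n = R.trans (⊛-suc 𝕩 f n)
    (R.trans (R.+-cong (R.zeroˡ _) (⊛-identityˡ f n)) (R.+-identityˡ (f n)))

  constant : Carrier → Ser
  constant x zero    = x
  constant x (suc n) = R.0#

  constant-⊛ : ∀ x f → constant x ⊛ f ≋ x · f
  constant-⊛ x f n = R.trans (sum-head n _)
    (R.trans (R.+-congˡ (R.trans (sum-cong n (λ i _ → R.zeroˡ _)) (sum-zero n))) (R.+-identityʳ _))

  commutativeRing : CommutativeRing c ℓ
  commutativeRing = record
    { Carrier = Ser ; _≈_ = _≋_ ; _+_ = _⊕_ ; _*_ = _⊛_ ; -_ = ⊝_ ; 0# = 0ˢ ; 1# = 1ˢ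
    ; isCommutativeRing = record
      { isRing = record
        { +-isAbelianGroup = record
          { isGroup = record
            { isMonoid = record
              { isSemigroup = record
                { isMagma = record
                  { isEquivalence = record
                    { refl = λ _ → R.refl ; sym = λ eq n → R.sym (eq n) ; trans = λ p q n → R.trans (p n) (q n) }
                  ; ∙-cong = λ p q n → R.+-cong (p n) (q n) }
                ; assoc = λ f g h n → R.+-assoc (f n) (g n) (h n) }
              ; identity = (λ f n → R.+-identityˡ (f n)) , (λ f n → R.+-identityʳ (f n)) }
            ; inverse = (λ f n → R.-‿inverseˡ (f n)) , (λ f n → R.-‿inverseʳ (f n))
            ; ⁻¹-cong = λ p n → R.-‿cong (p n) }
          ; comm = λ f g n → R.+-comm (f n) (g n) }
        ; *-cong = ⊛-cong
        ; *-assoc = ⊛-assoc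
        ; *-identity = ⊛-identityˡ , (λ f n → R.trans (⊛-comm f 1ˢ n) (⊛-identityˡ f n))
        ; distrib = ⊛-distribˡ , ⊛-distribʳ }
      ; *-comm = ⊛-comm } }

-- The functional equation over an arbitrary commutative ring

module RingIdentities {c ℓ} (R : CommutativeRing c ℓ) where

  private module R = CommutativeRing R
  open R hiding (refl; sym; trans)
  open SetoidReasoning setoid
  open SemiringSolver commutativeSemiring
  open GroupProperties +-group using () renaming (∙-cancelʳ to +-cancelʳ)

  -- The relation v = 1 - s is stated additively, here and below: all remaining identities are then
  -- identities of commutative semirings, combined with cancellation.
  absorb : ∀ {v s} → v + s ≈ 1# → ∀ {x r} → x ≈ r + s * x → v * x ≈ r
  absorb {v} {s} v+s≈1 {x} {r} eq = +-cancelʳ (s * x) _ _ (begin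
    v * x + s * x  ≈⟨ distribʳ x v s ⟨
    (v + s) * x    ≈⟨ *-congʳ v+s≈1 ⟩
    1# * x         ≈⟨ *-identityˡ x ⟩
    x              ≈⟨ eq ⟩
    r + s * x      ∎)

  divide : ∀ {u u′} → u * u′ ≈ 1# → ∀ {x r} → u * x ≈ r → x ≈ r * u′
  divide {u} {u′} uu′≈1 {x} {r} eq = begin
    x              ≈⟨ *-identityˡ x ⟨
    1# * x         ≈⟨ *-congʳ uu′≈1 ⟨
    u * u′ * x     ≈⟨ solve 3 (λ u u′ x → u :* u′ :* x := u :* x :* u′) R.refl u u′ x ⟩
    u * x * u′     ≈⟨ *-congʳ eq ⟩
    r * u′         ∎

  regroup-A : ∀ t s A z B → t * s * (A + z * B) ≈ t * (s * A) + t * z * (s * B)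
  regroup-A = solve 5 (λ t s A z B → t :* s :* (A :+ z :* B) := t :* (s :* A) :+ t :* z :* (s :* B)) R.refl

  regroup-B : ∀ t s Y B H → t * s * (Y * (B + H)) ≈ t * Y * (s * B) + Y * (t * s * H)
  regroup-B = solve 5 (λ t s Y B H →
    t :* s :* (Y :* (B :+ H)) := t :* Y :* (s :* B) :+ Y :* (t :* s :* H)) R.refl

  regroup-Φ : ∀ X s q T → s * (X * (q * T)) ≈ X * (s * q * T)
  regroup-Φ = solve 4 (λ X s q T → s :* (X :* (q :* T)) := X :* (s :* q :* T)) R.refl

  distribute-factor : ∀ {z Y} → z + 1# ≈ Y → ∀ x → Y * x ≈ x + z * x
  distribute-factor {z} {Y} z+1≈Y x = R.trans (*-congʳ (R.sym z+1≈Y))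
    (solve 2 (λ z x → (z :+ con 1) :* x := x :+ z :* x) R.refl z x)

  -- Here `z`, `u`, `v` stand for y - 1, 1 - yt, 1 - t. Below, `Φ` and `Φ′` are the values of the
  -- series Φ at s and at t, and `α`, `β` are the sums of t^k `A k` and t^k `B k`.
  module _ {X Y z t u v : Carrier} (z+1≈Y : z + 1# ≈ Y) (u+Yt≈1 : u + Y * t ≈ 1#) (v+t≈1 : v + t ≈ 1#) where

    -- This cancels the denominator 1 - t in the term without F, which keeps only 1 - yt.
    u+tz≈v : u + t * z ≈ v
    u+tz≈v = +-cancelʳ t _ _ (begin
      u + t * z + t      ≈⟨ solve 3 (λ u t z → u :+ t :* z :+ t := u :+ (z :+ con 1) :* t) R.refl u t z ⟩
      u + (z + 1#) * t   ≈⟨ +-congˡ (*-congʳ z+1≈Y) ⟩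
      u + Y * t          ≈⟨ u+Yt≈1 ⟩
      1#                 ≈⟨ v+t≈1 ⟨
      v + t              ∎)

    module _ {F Φ Φ′ α β : Carrier}
             (α-eq : α ≈ Y + Y * F + t * (α + z * β))
             (β-eq : β ≈ Y + t * Y * β + Y * Φ′)
             (Φ-eq : Φ + X * t * (Y * F) ≈ X * t * α) where

      vα : v * α ≈ Y + Y * F + t * (z * β)
      vα = absorb v+t≈1 (R.trans α-eq (solve 5
        (λ Y F t α w → Y :+ Y :* F :+ t :* (α :+ w) := Y :+ Y :* F :+ t :* w :+ t :* α) R.refl Y F t α (z * β)))

      uβ : u * β ≈ Y + Y * Φ′
      uβ = absorb u+Yt≈1 (R.trans β-eq (solve 4
        (λ Y t β Φ′ → Y :+ t :* Y :* β :+ Y :* Φ′ := Y :+ Y :* Φ′ :+ Y :* t :* β) R.refl Y t β Φ′))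

      -- Multiplying by `u * v` lets `vα` and then `uβ` eliminate both auxiliary sums. The surplus
      -- term of `Φ-eq` is carried on both sides and cancelled at the end.
      cleared : u * v * Φ ≈ X * Y * t * v + X * Y * (t * t) * u * F + X * Y * (t * t) * z * Φ′
      cleared = +-cancelʳ (u * v * (X * t * (Y * F))) _ _ (begin
        u * v * Φ + u * v * (X * t * (Y * F))
          ≈⟨ distribˡ (u * v) Φ _ ⟨
        u * v * (Φ + X * t * (Y * F))
          ≈⟨ *-congˡ Φ-eq ⟩
        u * v * (X * t * α)
          ≈⟨ solve 5 (λ u v X t α → u :* v :* (X :* t :* α) := X :* t :* u :* (v :* α)) R.refl u v X t α ⟩
        X * t * u * (v * α)
          ≈⟨ *-congˡ vα ⟩
        X * t * u * (Y + Y * F + t * (z * β))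
          ≈⟨ solve 7 (λ X t u Y F z β → X :* t :* u :* (Y :+ Y :* F :+ t :* (z :* β)) :=
                 X :* t :* u :* (Y :+ Y :* F) :+ X :* t :* t :* z :* (u :* β)) R.refl X t u Y F z β ⟩
        X * t * u * (Y + Y * F) + X * t * t * z * (u * β)
          ≈⟨ +-congˡ (*-congˡ uβ) ⟩
        X * t * u * (Y + Y * F) + X * t * t * z * (Y + Y * Φ′)
          ≈⟨ solve 7 (λ X t u Y F z Φ′ →
                 X :* t :* u :* (Y :+ Y :* F) :+ X :* t :* t :* z :* (Y :+ Y :* Φ′) :=
                 X :* Y :* t :* (u :+ t :* z) :+ X :* Y :* t :* u :* F :+ X :* Y :* (t :* t) :* z :* Φ′) R.refl X t u Y F z Φ′ ⟩
        X * Y * t * (u + t * z) + X * Y * t * u * F + X * Y * (t * t) * z * Φ′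
          -- The F term is multiplied by `v + t`, which is 1: the `v` part is exactly the surplus to
          -- be cancelled, and the `t` part is the source of t².
          ≈⟨ +-congʳ (+-cong (*-congˡ u+tz≈v) (R.trans (R.sym (*-identityˡ _)) (*-congʳ (R.sym v+t≈1)))) ⟩
        X * Y * t * v + (v + t) * (X * Y * t * u * F) + X * Y * (t * t) * z * Φ′
          ≈⟨ solve 8 (λ X Y t u v F z Φ′ →
                 X :* Y :* t :* v :+ (v :+ t) :* (X :* Y :* t :* u :* F) :+ X :* Y :* (t :* t) :* z :* Φ′ :=
                 X :* Y :* t :* v :+ X :* Y :* (t :* t) :* u :* F :+ X :* Y :* (t :* t) :* z :* Φ′
                   :+ u :* v :* (X :* t :* (Y :* F))) R.refl X Y t u v F z Φ′ ⟩
        X * Y * t * v + X * Y * (t * t) * u * F + X * Y * (t * t) * z * Φ′ + u * v * (X * t * (Y * F)) ∎)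

      -- The inverse `w` of `u * v` is kept apart from `u′` and `v′` because the factors of
      -- `commonProduct` invert such a product as a whole.
      functionalEquation : ∀ {u′ v′ w} → u * u′ ≈ 1# → v * v′ ≈ 1# → u * v * w ≈ 1# →
        Φ ≈ X * Y * t * u′ + X * Y * (t * t) * v′ * F + X * Y * (t * t) * z * w * Φ′
      functionalEquation {u′} {v′} {w} uu′≈1 vv′≈1 uvw≈1 = begin
        Φ
          ≈⟨ divide uvw≈1 cleared ⟩
        (X * Y * t * v + X * Y * (t * t) * u * F + X * Y * (t * t) * z * Φ′) * w
          ≈⟨ solve 9 (λ X Y t u v F z Φ′ w →
                 (X :* Y :* t :* v :+ X :* Y :* (t :* t) :* u :* F :+ X :* Y :* (t :* t) :* z :* Φ′) :* w :=
                 X :* Y :* t :* (v :* w) :+ X :* Y :* (t :* t) :* (u :* w) :* F :+ X :* Y :* (t :* t) :* z :* w :* Φ′)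
               R.refl X Y t u v F z Φ′ w ⟩
        X * Y * t * (v * w) + X * Y * (t * t) * (u * w) * F + X * Y * (t * t) * z * w * Φ′
          ≈⟨ +-congʳ (+-cong (*-congˡ vw≈u′) (*-congʳ (*-congˡ uw≈v′))) ⟩
        X * Y * t * u′ + X * Y * (t * t) * v′ * F + X * Y * (t * t) * z * w * Φ′ ∎
        where
        vw≈u′ : v * w ≈ u′
        vw≈u′ = R.trans (divide uu′≈1 (R.trans (R.sym (*-assoc u v w)) uvw≈1)) (*-identityˡ u′)
        uw≈v′ : u * w ≈ v′
        uw≈v′ = R.trans (divide vv′≈1 (R.trans (solve 3 (λ u v w → v :* (u :* w) := u :* v :* w) R.refl u v w) uvw≈1))
                      (*-identityˡ v′)

      -- In the ℓ-th step m, q, ζ and p are (XY)^ℓ, Q^(ℓ(ℓ+1)), (Y-1)^ℓ and the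
      -- common product of length ℓ, and m′, q₂, ζ′ belong to ℓ + 1.
      iterationStep : ∀ {u′ v′ w} → u * u′ ≈ 1# → v * v′ ≈ 1# → u * v * w ≈ 1# →
        ∀ {m m′ q q₁ q₂ ζ ζ′ p} → m′ ≈ m * (X * Y) → q₁ ≈ q * t → q₂ ≈ q * (t * t) → ζ′ ≈ ζ * z →
        ∀ {P N D P′} → P ≈ m * q * ζ * p → N ≈ m′ * q₁ * ζ * u′ * p → D ≈ m′ * q₂ * ζ * v′ * p →
        P′ ≈ m′ * q₂ * ζ′ * (p * w) →
        P * Φ ≈ N + D * F + P′ * Φ′
      iterationStep {u′} {v′} {w} uu′≈1 vv′≈1 uvw≈1 {m} {m′} {q} {q₁} {q₂} {ζ} {ζ′} {p} m′≈ q₁≈ q₂≈ ζ′≈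
                    {P} {N} {D} {P′} P≈ N≈ D≈ P′≈ = begin
        P * Φ
          ≈⟨ *-cong P≈ (functionalEquation uu′≈1 vv′≈1 uvw≈1) ⟩
        m * q * ζ * p * (X * Y * t * u′ + X * Y * (t * t) * v′ * F + X * Y * (t * t) * z * w * Φ′)
          ≈⟨ solve 13 (λ m q ζ p X Y t u′ v′ F z w Φ′ →
                 m :* q :* ζ :* p :* (X :* Y :* t :* u′ :+ X :* Y :* (t :* t) :* v′ :* F :+ X :* Y :* (t :* t) :* z :* w :* Φ′) :=
                 m :* (X :* Y) :* (q :* t) :* ζ :* u′ :* p
                   :+ m :* (X :* Y) :* (q :* (t :* t)) :* ζ :* v′ :* p :* F
                   :+ m :* (X :* Y) :* (q :* (t :* t)) :* (ζ :* z) :* (p :* w) :* Φ′)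
               R.refl m q ζ p X Y t u′ v′ F z w Φ′ ⟩
        m * (X * Y) * (q * t) * ζ * u′ * p + m * (X * Y) * (q * (t * t)) * ζ * v′ * p * F
          + m * (X * Y) * (q * (t * t)) * (ζ * z) * (p * w) * Φ′
          ≈⟨ +-cong (+-cong
               (*-congʳ (*-congʳ (*-congʳ (*-cong m′≈ q₁≈))))
               (*-congʳ (*-congʳ (*-congʳ (*-congʳ (*-cong m′≈ q₂≈))))))
               (*-congʳ (*-congʳ (*-cong (*-cong m′≈ q₂≈) ζ′≈))) ⟨
        m′ * q₁ * ζ * u′ * p + m′ * q₂ * ζ * v′ * p * F + m′ * q₂ * ζ′ * (p * w) * Φ′
          ≈⟨ +-cong (+-cong N≈ (*-congʳ D≈)) (*-congʳ P′≈) ⟨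
        N + D * F + P′ * Φ′ ∎

open import Data.List.Base using (List; []; _∷_; _++_; map; concatMap; length; upTo)
open import Data.List.Properties using (length-map; length-++; concatMap-++; upTo-∷ʳ; ++-identityʳ)
open import Data.Nat.Solver using (module +-*-Solver)
open import Defs
open import Data.Integer.Base using (+_)
open Defs.SeriesLemmas using (∑-cong; ∑-zero; ∑-+; ∑-extend; ∑³-cong; *-order; ^-order)
open Enumeration using (delay; firstColumn; afterFirst; secondColumn; heightLists; polyominoes)

-- The ring structure of `Series`, seen as power series in x over power series in y over power
-- series in q

module ℤ⟦q⟧ = PowerSeries ℤ.+-*-commutativeRing
module ℤ⟦q,y⟧ = PowerSeries ℤ⟦q⟧.commutativeRing
module ℤ⟦q,y,x⟧ = PowerSeries ℤ⟦q,y⟧.commutativeRing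

ℤ⟦q⟧-sum : ∀ n t → ℤ⟦q⟧.sum n t ≡ ∑ n t
ℤ⟦q⟧-sum zero    t = refl
ℤ⟦q⟧-sum (suc n) t = cong (ℤ._+ t n) (ℤ⟦q⟧-sum n t)

ℤ⟦q,y⟧-sum : ∀ n t k → ℤ⟦q,y⟧.sum n t k ≡ ∑[ j < n ] t j k
ℤ⟦q,y⟧-sum zero    t k = refl
ℤ⟦q,y⟧-sum (suc n) t k = cong (ℤ._+ t n k) (ℤ⟦q,y⟧-sum n t k)

ℤ⟦q,y,x⟧-sum : ∀ n t j k → ℤ⟦q,y,x⟧.sum n t j k ≡ ∑[ i < n ] t i j k
ℤ⟦q,y,x⟧-sum zero    t j k = refl
ℤ⟦q,y,x⟧-sum (suc n) t j k = cong (ℤ._+ t n j k) (ℤ⟦q,y,x⟧-sum n t j k)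

*-iterated : ∀ f g → f * g ≈ f ℤ⟦q,y,x⟧.⊛ g
*-iterated f g a b n = sym (trans (ℤ⟦q,y,x⟧-sum (suc a) _ b n)
  (∑-cong (suc a) λ i _ → trans (ℤ⟦q,y⟧-sum (suc b) _ n)
    (∑-cong (suc b) λ j _ → ℤ⟦q⟧-sum (suc n) _)))

1#-iterated : 1# ≈ ℤ⟦q,y,x⟧.1ˢ
1#-iterated zero    zero    zero    = refl
1#-iterated zero    zero    (suc n) = refl
1#-iterated zero    (suc b) n       = refl
1#-iterated (suc a) b       n       = refl

-- A record, because _≈_ unfolds to an equation between coefficients, and
-- conversion checking then unfolds the products on both sides.
infix 4 _≋_

record _≋_ (f g : Series) : Set where
  constructor pointwise
  field coefficients : f ≈ g

open _≋_

≋-rawRing : RawRing 0ℓ 0ℓ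
≋-rawRing = record
  { Carrier = Series ; _≈_ = _≋_ ; _+_ = _+_ ; _*_ = _*_ ; -_ = -_ ; 0# = 0# ; 1# = 1# }

-- The identity map between two presentations of one ring. Only the product and 1 need an argument;
-- the ring laws are then pulled back along it.
iterated-isRingMonomorphism :
  IsRingMonomorphism ≋-rawRing (CommutativeRing.rawRing ℤ⟦q,y,x⟧.commutativeRing) id
iterated-isRingMonomorphism = record
  { isRingHomomorphism = record
    { isSemiringHomomorphism = record
      { isNearSemiringHomomorphism = record
        { +-isMonoidHomomorphism = record
          { isMagmaHomomorphism = record
            { isRelHomomorphism = record { cong = coefficients }
            ; homo = λ _ _ _ _ _ → refl }
          ; ε-homo = λ _ _ _ → refl }
        ; *-homo = *-iterated }
      ; 1#-homo = 1#-iterated }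
    ; -‿homo = λ _ _ _ _ → refl }
  ; injective = pointwise }

series-isCommutativeRing : IsCommutativeRing _≋_ _+_ _*_ -_ 0# 1#
series-isCommutativeRing =
  RingMonomorphism.isCommutativeRing iterated-isRingMonomorphism
    (CommutativeRing.isCommutativeRing ℤ⟦q,y,x⟧.commutativeRing)

seriesRing : CommutativeRing 0ℓ 0ℓ
seriesRing = record { isCommutativeRing = series-isCommutativeRing }

module R = IsCommutativeRing series-isCommutativeRing

-- Not seriesRing: applied to a constructor, the projections in the statements
-- of RingIdentities reduce, and the operations of Series appear literally.
open RingIdentities (CommutativeRing.constructor Series _≋_ _+_ _*_ -_ 0# 1# series-isCommutativeRing)

module ≋-Reasoning = SetoidReasoning R.setoid

open CommutativeSemigroupProperties (CommutativeRing.+-commutativeSemigroup seriesRing)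
  using (interchange; xy∙z≈xz∙y)
open CommutativeSemigroupProperties (CommutativeRing.*-commutativeSemigroup seriesRing)
  using () renaming (interchange to *-interchange)

^-homo-* : ∀ f m n → f ^ (m ℕ.+ n) ≋ f ^ m * f ^ n
^-homo-* f zero    n = R.sym {1# * f ^ n} (R.*-identityˡ (f ^ n))
^-homo-* f (suc m) n = begin
  f * f ^ (m ℕ.+ n)    ≈⟨ R.*-congˡ {f} {f ^ (m ℕ.+ n)} {f ^ m * f ^ n} (^-homo-* f m n) ⟩
  f * (f ^ m * f ^ n)  ≈⟨ R.*-assoc f (f ^ m) (f ^ n) ⟨
  f * f ^ m * f ^ n    ∎
  where open ≋-Reasoning

^-congˡ : ∀ n {f g} → f ≋ g → f ^ n ≋ g ^ n
^-congˡ zero    f≋g = R.refl {1#}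
^-congˡ (suc n) {f} {g} f≋g = R.*-cong {f} {g} {f ^ n} {g ^ n} f≋g (^-congˡ n f≋g)

^-congʳ : ∀ f {m n} → m ≡ n → f ^ m ≋ f ^ n
^-congʳ f {m} refl = R.refl {f ^ m}

^-distrib-* : ∀ f g n → (f * g) ^ n ≋ f ^ n * g ^ n
^-distrib-* f g zero    = R.sym {1# * 1#} (R.*-identityˡ 1#)
^-distrib-* f g (suc n) = begin
  f * g * (f * g) ^ n      ≈⟨ R.*-congˡ {f * g} {(f * g) ^ n} {f ^ n * g ^ n} (^-distrib-* f g n) ⟩
  f * g * (f ^ n * g ^ n)  ≈⟨ *-interchange f g (f ^ n) (g ^ n) ⟩
  f * f ^ n * (g * g ^ n)  ∎
  where open ≋-Reasoning

^-snoc : ∀ f n → f ^ (n ℕ.+ 1) ≋ f ^ n * f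
^-snoc f n = R.trans {f ^ (n ℕ.+ 1)} {f ^ n * f ^ 1} {f ^ n * f}
  (^-homo-* f n 1) (R.*-congˡ {f ^ n} {f ^ 1} {f} (R.*-identityʳ f))

1^n≋1 : ∀ n → 1# ^ n ≋ 1#
1^n≋1 zero    = R.refl {1#}
1^n≋1 (suc n) = R.trans {1# ^ suc n} {1# ^ n} {1#} (R.*-identityˡ (1# ^ n)) (1^n≋1 n)

sub-add : ∀ f g → f - g + g ≋ f
sub-add f g = pointwise λ a b n → trans (ℤ.+-assoc (f a b n) _ _)
  (trans (cong (λ s → f a b n ℤ.+ s) (ℤ.+-inverseˡ (g a b n))) (ℤ.+-identityʳ _))

inverse : ∀ f → f 0 0 0 ≡ 1ℤ → f * f ⁻¹ ≋ 1#
inverse f f₀≡1 = pointwise (*-inverseʳ f f₀≡1)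

*-constant : ∀ f g → f 0 0 0 ≡ 1ℤ → g 0 0 0 ≡ 1ℤ → (f * g) 0 0 0 ≡ 1ℤ
*-constant f g f₀≡1 g₀≡1 rewrite f₀≡1 | g₀≡1 = refl

-- Orders and infinite sums

Summable : (ℕ → Series) → Set
Summable f = ∀ ℓ → OrderAtLeast ℓ (f ℓ)

order-mono : ∀ {p r f} → p ≤ r → OrderAtLeast r f → OrderAtLeast p f
order-mono p≤r o a b n lt = o a b n (ℕ.<-≤-trans lt p≤r)

order-≋ : ∀ {p f g} → f ≋ g → OrderAtLeast p g → OrderAtLeast p f
order-≋ f≋g o a b n lt = trans (coefficients f≋g a b n) (o a b n lt)

order-*ˡ : ∀ {p} f {g} → OrderAtLeast p g → OrderAtLeast p (f * g)
order-*ˡ f = *-order {p = 0} {f = f} (λ _ _ _ ())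

order-*ʳ : ∀ {p f} g → OrderAtLeast p f → OrderAtLeast p (f * g)
order-*ʳ {p} {f} g o = order-≋ (R.*-comm f g) (order-*ˡ g o)

order-constant : ∀ {f} → f 0 0 0 ≡ 0ℤ → OrderAtLeast 1 f
order-constant f₀≡0 zero    zero    zero    _        = f₀≡0
order-constant f₀≡0 zero    zero    (suc n) (s≤s ())
order-constant f₀≡0 zero    (suc b) n       (s≤s ())
order-constant f₀≡0 (suc a) b       n       (s≤s ())

1-order : ∀ {f} → OrderAtLeast 1 f → (1# - f) 0 0 0 ≡ 1ℤ
1-order of = cong (λ c → 1ℤ ℤ.- c) (of 0 0 0 (s≤s z≤n))

∑ˢ : ℕ → (ℕ → Series) → Series
∑ˢ N f a b n = ∑[ ℓ < N ] f ℓ a b n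

∑ˢ-cong : ∀ N {f g : ℕ → Series} → (∀ ℓ → ℓ < N → f ℓ ≋ g ℓ) → ∑ˢ N f ≋ ∑ˢ N g
∑ˢ-cong N eq = pointwise λ a b n → ∑-cong N (λ ℓ ℓ<N → coefficients (eq ℓ ℓ<N) a b n)

∑ˢ-suc : ∀ N f → ∑ˢ (suc N) f ≋ ∑ˢ N f + f N
∑ˢ-suc N f = pointwise λ a b n → refl

*-∑ˢ : ∀ N g f → g * ∑ˢ N f ≋ ∑ˢ N (λ ℓ → g * f ℓ)
*-∑ˢ zero    g f = R.zeroʳ g
*-∑ˢ (suc N) g f = begin
  g * ∑ˢ (suc N) f           ≈⟨ R.distribˡ g (∑ˢ N f) (f N) ⟩
  g * ∑ˢ N f + g * f N       ≈⟨ R.+-congʳ {g * f N} (*-∑ˢ N g f) ⟩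
  ∑ˢ (suc N) (λ ℓ → g * f ℓ) ∎
  where open ≋-Reasoning

∑∞-cong : ∀ {f g : ℕ → Series} → (∀ ℓ → f ℓ ≋ g ℓ) → ∑∞ f ≋ ∑∞ g
∑∞-cong eq = pointwise λ a b n → ∑-cong (suc (a ℕ.+ b ℕ.+ n)) (λ ℓ _ → coefficients (eq ℓ) a b n)

∑∞-+ : ∀ (f g : ℕ → Series) → ∑∞ (λ ℓ → f ℓ + g ℓ) ≋ ∑∞ f + ∑∞ g
∑∞-+ f g = pointwise λ a b n → ∑-+ (suc (a ℕ.+ b ℕ.+ n)) _ _

-- The cut-off of `∑∞` depends on the coefficient. Replacing it by any larger bound gives the
-- coefficients that enter a product a common one.
∑∞-truncate : ∀ {f} → Summable f → ∀ {N} a b n → a ℕ.+ b ℕ.+ n < N → ∑ˢ N f a b n ≡ ∑∞ f a b n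
∑∞-truncate {f} sf a b n lt = ∑-extend (λ ℓ → f ℓ a b n) (λ ℓ → sf ℓ a b n) lt

∑∞-* : ∀ g {f} → Summable f → ∑∞ (λ ℓ → g * f ℓ) ≋ g * ∑∞ f
∑∞-* g {f} sf = pointwise λ a b n → let N = suc (a ℕ.+ b ℕ.+ n) in begin
  ∑ˢ N (λ ℓ → g * f ℓ) a b n  ≡⟨ coefficients (*-∑ˢ N g f) a b n ⟨
  (g * ∑ˢ N f) a b n          ≡⟨ ∑³-cong a b n (λ i j k _ _ _ → cong (g i j k ℤ.*_)
                                  (∑∞-truncate sf (a ∸ i) (b ∸ j) (n ∸ k) (bound a b n i j k))) ⟩
  (g * ∑∞ f) a b n            ∎
  where
  open ≡-Reasoning
  bound : ∀ a b n i j k → (a ∸ i) ℕ.+ (b ∸ j) ℕ.+ (n ∸ k) < suc (a ℕ.+ b ℕ.+ n)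
  bound a b n i j k = s≤s (ℕ.+-mono-≤ (ℕ.+-mono-≤ (ℕ.m∸n≤m a i) (ℕ.m∸n≤m b j)) (ℕ.m∸n≤m n k))

∑-first : ∀ N (t : ℕ → ℤ) → ∑ (suc N) t ≡ t 0 ℤ.+ ∑ N (t ∘ suc)
∑-first zero    t = ℤ.+-comm 0ℤ (t 0)
∑-first (suc N) t = trans (cong (ℤ._+ t (suc N)) (∑-first N t)) (ℤ.+-assoc (t 0) _ _)

∑∞-first : ∀ {f} → Summable f → ∑∞ f ≋ f 0 + ∑∞ (f ∘ suc)
∑∞-first {f} sf = pointwise λ a b n → trans
  (sym (∑∞-truncate sf a b n (ℕ.m≤n⇒m≤1+n (ℕ.n<1+n (a ℕ.+ b ℕ.+ n)))))
  (∑-first (suc (a ℕ.+ b ℕ.+ n)) (λ ℓ → f ℓ a b n))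

∑∞-finite : ∀ {f} k → Summable f → (∀ j → k ≤ j → f j ≋ 0#) → ∑∞ f ≋ ∑ˢ k f
∑∞-finite {f} k sf f≋0 = pointwise λ a b n → trans
  -- The partial sum up to the maximum of `k` and the cut-off extends both sides.
  (sym (∑∞-truncate sf a b n (ℕ.m≤n⊔m k (suc (a ℕ.+ b ℕ.+ n)))))
  (∑-extend (λ ℓ → f ℓ a b n) (λ j k≤j → coefficients (f≋0 j k≤j) a b n) (ℕ.m≤m⊔n k (suc (a ℕ.+ b ℕ.+ n))))

∑∞-order : ∀ {f} → (∀ ℓ → OrderAtLeast (ℓ ℕ.+ 1) (f ℓ)) → OrderAtLeast 1 (∑∞ f)
∑∞-order {f} of a b n lt = ∑-zero (suc (a ℕ.+ b ℕ.+ n)) λ ℓ →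
  order-mono {f = f ℓ} (ℕ.m≤n+m 1 ℓ) (of ℓ) a b n lt

-- After N steps the remainder `r N` has order at least N and so misses every coefficient of total
-- degree below N.
∑∞-telescope : ∀ {g r : ℕ → Series} → (∀ ℓ → r ℓ ≋ g ℓ + r (suc ℓ)) → Summable r → r 0 ≋ ∑∞ g
∑∞-telescope {g} {r} step or = pointwise λ a b n → let N = suc (a ℕ.+ b ℕ.+ n) in trans
  (coefficients (partial N) a b n)
  (trans (cong (λ c → ∑∞ g a b n ℤ.+ c) (or N a b n ℕ.≤-refl)) (ℤ.+-identityʳ _))
  where
  open ≋-Reasoning
  partial : ∀ N → r 0 ≋ ∑ˢ N g + r N
  partial zero    = R.sym (R.+-identityˡ (r 0))
  partial (suc N) = begin
    r 0                             ≈⟨ partial N ⟩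
    ∑ˢ N g + r N                    ≈⟨ R.+-congˡ {∑ˢ N g} (step N) ⟩
    ∑ˢ N g + (g N + r (suc N))      ≈⟨ R.+-assoc (∑ˢ N g) (g N) (r (suc N)) ⟨
    ∑ˢ N g + g N + r (suc N)        ≈⟨ R.+-congʳ {r (suc N)} (∑ˢ-suc N g) ⟨
    ∑ˢ (suc N) g + r (suc N)        ∎

∑∞-linear : ∀ (f g : ℕ → Series) h → Summable g → ∑∞ (λ ℓ → f ℓ + g ℓ * h) ≋ ∑∞ f + ∑∞ g * h
∑∞-linear f g h sg = begin
  ∑∞ (λ ℓ → f ℓ + g ℓ * h)   ≈⟨ ∑∞-+ f (λ ℓ → g ℓ * h) ⟩
  ∑∞ f + ∑∞ (λ ℓ → g ℓ * h)  ≈⟨ R.+-congˡ {∑∞ f} (∑∞-cong λ ℓ → R.*-comm (g ℓ) h) ⟩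
  ∑∞ f + ∑∞ (λ ℓ → h * g ℓ)  ≈⟨ R.+-congˡ {∑∞ f} (∑∞-* h sg) ⟩
  ∑∞ f + h * ∑∞ g            ≈⟨ R.+-congˡ {∑∞ f} (R.*-comm h (∑∞ g)) ⟩
  ∑∞ f + ∑∞ g * h            ∎
  where open ≋-Reasoning

solve-linear : ∀ f g h → OrderAtLeast 1 g → h ≋ f + g * h → h ≈ f / (1# - g)
solve-linear f g h og h≋ = coefficients (divide {1# - g} {(1# - g) ⁻¹}
  (inverse (1# - g) (1-order {g} og)) {h} {f}
  (absorb {1# - g} {g} (sub-add 1# g) {h} {f} h≋))

-- Coefficients of products with powers of the variables

-- X is the outermost variable; Y and Q are constants of one and of two outer levels respectively,
-- which is why they need `constant`.
X≈𝕩 : X ≈ ℤ⟦q,y,x⟧.𝕩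
X≈𝕩 zero          b       n       = refl
X≈𝕩 (suc zero)    zero    zero    = refl
X≈𝕩 (suc zero)    zero    (suc n) = refl
X≈𝕩 (suc zero)    (suc b) n       = refl
X≈𝕩 (suc (suc a)) b       n       = refl

Y≈𝕩 : Y ≈ ℤ⟦q,y,x⟧.constant ℤ⟦q,y⟧.𝕩
Y≈𝕩 zero    zero          n       = refl
Y≈𝕩 zero    (suc zero)    zero    = refl
Y≈𝕩 zero    (suc zero)    (suc n) = refl
Y≈𝕩 zero    (suc (suc b)) n       = refl
Y≈𝕩 (suc a) b             n       = refl

Q≈𝕩 : Q ≈ ℤ⟦q,y,x⟧.constant (ℤ⟦q,y⟧.constant ℤ⟦q⟧.𝕩)
Q≈𝕩 zero    zero    zero          = refl
Q≈𝕩 zero    zero    (suc zero)    = refl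
Q≈𝕩 zero    zero    (suc (suc n)) = refl
Q≈𝕩 zero    (suc b) n             = refl
Q≈𝕩 (suc a) b       n             = refl

*-iterated-congʳ : ∀ {f f′} g → f ≈ f′ → f * g ≈ f′ ℤ⟦q,y,x⟧.⊛ g
*-iterated-congʳ {f} {f′} g f≈f′ a b n = trans (*-iterated f g a b n)
  (ℤ⟦q,y,x⟧.⊛-cong {f = f} {f′ = f′} {g = g} f≈f′ (λ _ _ _ → refl) a b n)

X*-zero : ∀ f b n → (X * f) 0 b n ≡ 0ℤ
X*-zero f b n = trans (*-iterated-congʳ f X≈𝕩 0 b n) (ℤ⟦q,y,x⟧.𝕩⊛-zero f b n)

X*-suc : ∀ f a b n → (X * f) (suc a) b n ≡ f a b n
X*-suc f a b n = trans (*-iterated-congʳ f X≈𝕩 (suc a) b n) (ℤ⟦q,y,x⟧.𝕩⊛-suc f a b n)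

Y*-coefficient : ∀ f a b n → (Y * f) a b n ≡ (ℤ⟦q,y⟧.𝕩 ℤ⟦q,y⟧.⊛ f a) b n
Y*-coefficient f a b n = trans (*-iterated-congʳ f Y≈𝕩 a b n) (ℤ⟦q,y,x⟧.constant-⊛ ℤ⟦q,y⟧.𝕩 f a b n)

Q*-coefficient : ∀ f a b n → (Q * f) a b n ≡ (ℤ⟦q⟧.𝕩 ℤ⟦q⟧.⊛ f a b) n
Q*-coefficient f a b n = trans (*-iterated-congʳ f Q≈𝕩 a b n)
  (trans (ℤ⟦q,y,x⟧.constant-⊛ (ℤ⟦q,y⟧.constant ℤ⟦q⟧.𝕩) f a b n) (ℤ⟦q,y⟧.constant-⊛ ℤ⟦q⟧.𝕩 (f a) b n))

Y^*-coefficient : ∀ p f a b n → (Y ^ p * f) a b n ≡ delay 0ℤ p (λ b′ → f a b′ n) b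
Y^*-coefficient zero    f a b n = coefficients (R.*-identityˡ f) a b n
Y^*-coefficient (suc p) f a b n = trans (coefficients (R.*-assoc Y (Y ^ p) f) a b n)
  (trans (Y*-coefficient (Y ^ p * f) a b n) (shifted b))
  where
  shifted : ∀ b → (ℤ⟦q,y⟧.𝕩 ℤ⟦q,y⟧.⊛ (Y ^ p * f) a) b n ≡ delay 0ℤ (suc p) (λ b′ → f a b′ n) b
  shifted zero    = ℤ⟦q,y⟧.𝕩⊛-zero ((Y ^ p * f) a) n
  shifted (suc b) = trans (ℤ⟦q,y⟧.𝕩⊛-suc ((Y ^ p * f) a) b n) (Y^*-coefficient p f a b n)

Q^*-coefficient : ∀ p f a b n → (Q ^ p * f) a b n ≡ delay 0ℤ p (f a b) n
Q^*-coefficient zero    f a b n = coefficients (R.*-identityˡ f) a b n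
Q^*-coefficient (suc p) f a b n = trans (coefficients (R.*-assoc Q (Q ^ p) f) a b n)
  (trans (Q*-coefficient (Q ^ p * f) a b n) (shifted n))
  where
  shifted : ∀ n → (ℤ⟦q⟧.𝕩 ℤ⟦q⟧.⊛ (Q ^ p * f) a b) n ≡ delay 0ℤ (suc p) (f a b) n
  shifted zero    = ℤ⟦q⟧.𝕩⊛-zero ((Q ^ p * f) a b)
  shifted (suc n) = trans (ℤ⟦q⟧.𝕩⊛-suc ((Q ^ p * f) a b) n) (Q^*-coefficient p f a b n)

delay-map : ∀ {A B : Set} (φ : A → B) {d e} → φ d ≡ e → ∀ p {g h} → (∀ m → φ (g m) ≡ h m) →
            ∀ n → φ (delay d p g n) ≡ delay e p h n
delay-map φ φd≡e zero    eq n       = eq n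
delay-map φ φd≡e (suc p) eq zero    = φd≡e
delay-map φ φd≡e (suc p) eq (suc n) = delay-map φ φd≡e p eq n

delay-zero : ∀ p {g} → (∀ m → g m ≡ 0ℤ) → ∀ n → delay 0ℤ p g n ≡ 0ℤ
delay-zero zero    eq n       = eq n
delay-zero (suc p) eq zero    = refl
delay-zero (suc p) eq (suc n) = delay-zero p eq n

Y^-coefficient : ∀ p a b n → (Y ^ p) a b n ≡ delay 0ℤ p (λ b′ → 1# a b′ n) b
Y^-coefficient p a b n = trans (sym (coefficients (R.*-identityʳ (Y ^ p)) a b n)) (Y^*-coefficient p 1# a b n)

Y^-suc : ∀ p a b n → (Y ^ p) (suc a) b n ≡ 0ℤ
Y^-suc p a b n = trans (Y^-coefficient p (suc a) b n) (delay-zero p (λ _ → refl) b)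

1#-q-coefficient : ∀ b n → 1# 0 b (suc n) ≡ 0ℤ
1#-q-coefficient zero    n = refl
1#-q-coefficient (suc b) n = refl

-- The generating functions by height of the first column

length-concatMap-upTo : ∀ {A : Set} (f : ℕ → List A) n →
                        + length (concatMap f (upTo n)) ≡ ∑[ j < n ] (+ length (f j))
length-concatMap-upTo f zero    = refl
length-concatMap-upTo f (suc n) = begin
  + length (concatMap f (upTo (suc n)))
    ≡⟨ cong (λ js → + length (concatMap f js)) (upTo-∷ʳ n) ⟨
  + length (concatMap f (upTo n ++ n ∷ []))
    ≡⟨ cong (+_ ∘ length) (concatMap-++ f (upTo n) (n ∷ [])) ⟩
  + length (concatMap f (upTo n) ++ (f n ++ []))
    ≡⟨ cong (λ ys → + length (concatMap f (upTo n) ++ ys)) (++-identityʳ (f n)) ⟩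
  + length (concatMap f (upTo n) ++ f n)
    ≡⟨ cong +_ (length-++ (concatMap f (upTo n))) ⟩
  + length (concatMap f (upTo n)) ℤ.+ + length (f n)
    ≡⟨ cong (ℤ._+ + length (f n)) (length-concatMap-upTo f n) ⟩
  ∑[ j < suc n ] (+ length (f j)) ∎
  where open ≡-Reasoning

-- `T k` is what actually remains of `H k` once x q^(k+1) is divided out; it agrees with `A k`
-- except for k = 0. The exponent `suc (k ∸ suc j)` is max (k - j) 1.
H T A : ℕ → Series
H k a b n = + length (firstColumn k a b n)
T k a b n = + length (afterFirst k a b n)
A k = Y ^ suc k + ∑∞ (λ j → Y ^ suc (k ∸ suc j) * H j)

F : Series
F = ∑∞ H

F-isGeneratingFunction : IsGeneratingFunction F
F-isGeneratingFunction a b n =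
  length (heightLists a b n)
  , sym (length-concatMap-upTo (λ k → firstColumn k a b n) (suc (a ℕ.+ b ℕ.+ n)))
  , polyominoes a b n

H≋ : ∀ k → H k ≋ X * (Q ^ suc k * T k)
H≋ k = pointwise λ
  { zero    b n → sym (X*-zero (Q ^ suc k * T k) b n)
  ; (suc a) b n → trans
      (delay-map (+_ ∘ length) refl (suc k) (λ _ → refl) n)
      (sym (trans (X*-suc (Q ^ suc k * T k) a b n) (Q^*-coefficient (suc k) (T k) a b n)))
  }

H-order : ∀ k → OrderAtLeast (suc k) (H k)
H-order k = order-≋ (H≋ k) (order-*ˡ X (order-*ʳ (T k) (^-order (order-constant {Q} refl) (suc k))))

-- The area of the first column alone forces convergence, whatever the weights; so `Φ` also makes
-- sense at s = 1.
H-summable : ∀ (c : ℕ → Series) → Summable (λ j → c j * H j)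
H-summable c j = order-*ˡ (c j) (order-mono (ℕ.n≤1+n j) (H-order j))

T-single : ∀ k b n → T k 0 b n ≡ (Y ^ suc k) 0 b n
T-single k b zero    = trans
  (delay-map (+_ ∘ length) refl (suc k) (λ { zero → refl ; (suc _) → refl }) b)
  (sym (Y^-coefficient (suc k) 0 b 0))
T-single k b (suc n) = sym (trans (Y^-coefficient (suc k) 0 b (suc n))
  (delay-zero (suc k) (λ b → 1#-q-coefficient b n) b))

T-zero : T 0 ≋ Y ^ 1
T-zero = pointwise λ
  { zero    b n → T-single 0 b n
  ; (suc a) b n → sym (Y^-suc 1 a b n)
  }

-- In degree 0 in x only the power of Y in `A` contributes, since every polyomino has a column; in
-- positive degree only the sum does.
T-suc : ∀ k → T (suc k) ≋ A (suc k)
T-suc k = pointwise go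
  where
  open ≡-Reasoning
  go : T (suc k) ≈ A (suc k)
  go zero b n = begin
    T (suc k) 0 b n
      ≡⟨ T-single (suc k) b n ⟩
    (Y ^ suc (suc k)) 0 b n
      ≡⟨ ℤ.+-identityʳ _ ⟨
    (Y ^ suc (suc k)) 0 b n ℤ.+ 0ℤ
      ≡⟨ cong (λ s → (Y ^ suc (suc k)) 0 b n ℤ.+ s) (∑-zero (suc (0 ℕ.+ b ℕ.+ n)) λ j →
           trans (Y^*-coefficient (suc (k ∸ j)) (H j) 0 b n) (delay-zero (suc (k ∸ j)) (λ _ → refl) b)) ⟨
    A (suc k) 0 b n ∎
  go (suc a) b n = begin
    + length (map (suc (suc k) ∷_) (concatMap (secondColumn k (suc a) b n) (upTo N)))
      ≡⟨ cong +_ (length-map (suc (suc k) ∷_) (concatMap (secondColumn k (suc a) b n) (upTo N))) ⟩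
    + length (concatMap (secondColumn k (suc a) b n) (upTo N))
      ≡⟨ length-concatMap-upTo (secondColumn k (suc a) b n) N ⟩
    ∑[ j < N ] (+ length (secondColumn k (suc a) b n j))
      ≡⟨ ∑-cong N (λ j _ → trans
           (delay-map (+_ ∘ length) refl (suc (k ∸ j)) (λ _ → refl) b)
           (sym (Y^*-coefficient (suc (k ∸ j)) (H j) (suc a) b n))) ⟩
    ∑∞ (λ j → Y ^ suc (k ∸ j) * H j) (suc a) b n
      ≡⟨ ℤ.+-identityˡ _ ⟨
    0ℤ ℤ.+ ∑∞ (λ j → Y ^ suc (k ∸ j) * H j) (suc a) b n
      ≡⟨ cong (ℤ._+ ∑∞ (λ j → Y ^ suc (k ∸ j) * H j) (suc a) b n) (Y^-suc (suc (suc k)) a b n) ⟨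
    A (suc k) (suc a) b n ∎
    where N = suc (suc a ℕ.+ b ℕ.+ n)

-- increment k j is Y ^ (k - j) for j < k and 0 otherwise.
increment : ℕ → ℕ → Series
increment zero    j       = 0#
increment (suc k) zero    = Y ^ suc k
increment (suc k) (suc j) = increment k j

increment-≥ : ∀ {k j} → k ≤ j → increment k j ≡ 0#
increment-≥ z≤n       = refl
increment-≥ (s≤s k≤j) = increment-≥ k≤j

increment-< : ∀ {k j} → j < k → increment k j ≡ Y ^ (k ∸ j)
increment-< {suc k} {zero}  _         = refl
increment-< {suc k} {suc j} (s≤s j<k) = increment-< j<k

-- Passing from k to k + 1 raises max (k - j) 1 by one if j < k and leaves it at 1 otherwise. This
-- is why only finitely many `H j` enter the difference of consecutive `A k`.
Y^-increment : ∀ k j → Y ^ suc (k ∸ j) ≋ Y ^ suc (k ∸ suc j) + (Y - 1#) * increment k j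
Y^-increment zero j with 0 ∸ j | ℕ.0∸n≡0 j
... | .0 | refl = R.sym (R.trans (R.+-congˡ {Y ^ 1} (R.zeroʳ (Y - 1#))) (R.+-identityʳ (Y ^ 1)))
Y^-increment (suc k) zero    = distribute-factor {Y - 1#} {Y} (sub-add Y 1#) (Y ^ suc k)
Y^-increment (suc k) (suc j) = Y^-increment k j

-- `B k` is the quotient of the difference `A (suc k) - A k` by `Y - 1#`; its power of Y stems from
-- the single column, whose exponent also grows by one.
lowerSum B : ℕ → Series
lowerSum k = ∑ˢ k (λ j → Y ^ (k ∸ j) * H j)
B k = Y ^ suc k + lowerSum k

∑∞-increment : ∀ k → ∑∞ (λ j → increment k j * H j) ≋ lowerSum k
∑∞-increment k = R.trans
  (∑∞-finite {λ j → increment k j * H j} k (H-summable (increment k)) λ j k≤j →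
    R.trans (R.*-congʳ {H j} (R.reflexive (increment-≥ k≤j))) (R.zeroˡ (H j)))
  (∑ˢ-cong k λ j j<k → R.*-congʳ {H j} (R.reflexive (increment-< j<k)))

-- For k = 0 all exponents are 1, so the sum is all of F, although nothing can follow a first column
-- of height 1.
A-zero : A 0 ≋ Y + Y * F
A-zero = begin
  Y ^ 1 + ∑∞ (λ j → Y ^ 1 * H j)
    ≈⟨ R.+-congˡ {Y ^ 1} (∑∞-* (Y ^ 1) {H} λ j → order-mono (ℕ.n≤1+n j) (H-order j)) ⟩
  Y ^ 1 + Y ^ 1 * F
    ≈⟨ R.+-cong (R.*-identityʳ Y) (R.*-congʳ {F} (R.*-identityʳ Y)) ⟩
  Y + Y * F ∎
  where open ≋-Reasoning

A-suc : ∀ k → A (suc k) ≋ A k + (Y - 1#) * B k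
A-suc k = begin
  Y ^ suc (suc k) + ∑∞ (λ j → Y ^ suc (k ∸ j) * H j)
    ≈⟨ R.+-cong (distribute-factor {Y - 1#} {Y} (sub-add Y 1#) (Y ^ suc k)) sums ⟩
  (Y ^ suc k + (Y - 1#) * Y ^ suc k) + (S + (Y - 1#) * lowerSum k)
    ≈⟨ interchange (Y ^ suc k) ((Y - 1#) * Y ^ suc k) S ((Y - 1#) * lowerSum k) ⟩
  Y ^ suc k + S + ((Y - 1#) * Y ^ suc k + (Y - 1#) * lowerSum k)
    ≈⟨ R.+-congˡ {A k} (R.distribˡ (Y - 1#) (Y ^ suc k) (lowerSum k)) ⟨
  A k + (Y - 1#) * B k ∎
  where
  open ≋-Reasoning
  S = ∑∞ (λ j → Y ^ suc (k ∸ suc j) * H j)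

  sums : ∑∞ (λ j → Y ^ suc (k ∸ j) * H j) ≋ S + (Y - 1#) * lowerSum k
  sums = begin
    ∑∞ (λ j → Y ^ suc (k ∸ j) * H j)
      ≈⟨ ∑∞-cong (λ j → begin
           Y ^ suc (k ∸ j) * H j
             ≈⟨ R.*-congʳ {H j} (Y^-increment k j) ⟩
           (Y ^ suc (k ∸ suc j) + (Y - 1#) * increment k j) * H j
             ≈⟨ R.distribʳ (H j) (Y ^ suc (k ∸ suc j)) ((Y - 1#) * increment k j) ⟩
           Y ^ suc (k ∸ suc j) * H j + (Y - 1#) * increment k j * H j
             ≈⟨ R.+-congˡ {Y ^ suc (k ∸ suc j) * H j} (R.*-assoc (Y - 1#) (increment k j) (H j)) ⟩
           Y ^ suc (k ∸ suc j) * H j + (Y - 1#) * (increment k j * H j) ∎) ⟩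
    ∑∞ (λ j → Y ^ suc (k ∸ suc j) * H j + (Y - 1#) * (increment k j * H j))
      ≈⟨ ∑∞-+ (λ j → Y ^ suc (k ∸ suc j) * H j) (λ j → (Y - 1#) * (increment k j * H j)) ⟩
    S + ∑∞ (λ j → (Y - 1#) * (increment k j * H j))
      ≈⟨ R.+-congˡ {S} (∑∞-* (Y - 1#) {λ j → increment k j * H j} (H-summable (increment k))) ⟩
    S + (Y - 1#) * ∑∞ (λ j → increment k j * H j)
      ≈⟨ R.+-congˡ {S} (R.*-congˡ {Y - 1#} (∑∞-increment k)) ⟩
    S + (Y - 1#) * lowerSum k ∎

B-zero : B 0 ≋ Y
B-zero = R.trans (R.+-identityʳ (Y ^ 1)) (R.*-identityʳ Y)

B-suc : ∀ k → B (suc k) ≋ Y * (B k + H k)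
B-suc k = begin
  Y ^ suc (suc k) + lowerSum (suc k)
    ≈⟨ R.+-congˡ {Y ^ suc (suc k)} (R.trans (∑ˢ-suc k (λ j → Y ^ (suc k ∸ j) * H j)) (R.+-cong
         (∑ˢ-cong k λ j j<k → R.trans
           (R.*-congʳ {H j} (^-congʳ Y (ℕ.+-∸-assoc 1 (ℕ.<⇒≤ j<k))))
           (R.*-assoc Y (Y ^ (k ∸ j)) (H j)))
         (R.*-congʳ {H k} (R.trans (^-congʳ Y (ℕ.m+n∸n≡m 1 k)) (R.*-identityʳ Y))))) ⟩
  Y ^ suc (suc k) + (∑ˢ k (λ j → Y * (Y ^ (k ∸ j) * H j)) + Y * H k)
    ≈⟨ R.+-congˡ {Y ^ suc (suc k)} (R.+-congʳ {Y * H k} (*-∑ˢ k Y (λ j → Y ^ (k ∸ j) * H j))) ⟨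
  Y * Y ^ suc k + (Y * lowerSum k + Y * H k)
    ≈⟨ R.+-assoc (Y * Y ^ suc k) (Y * lowerSum k) (Y * H k) ⟨
  Y * Y ^ suc k + Y * lowerSum k + Y * H k
    ≈⟨ R.+-congʳ {Y * H k} (R.distribˡ Y (Y ^ suc k) (lowerSum k)) ⟨
  Y * B k + Y * H k
    ≈⟨ R.distribˡ Y (B k) (H k) ⟨
  Y * (B k + H k) ∎
  where open ≋-Reasoning

-- Weighted sums over the first column and the functional equation

Φ : Series → Series
Φ s = ∑∞ (λ k → s ^ suc k * H k)

Φ-one : ∀ s → s ≋ 1# → Φ s ≋ F
Φ-one s s≋1 = ∑∞-cong λ k → R.trans {s ^ suc k * H k} {1# * H k} {H k}
  (R.*-congʳ {H k} {s ^ suc k} {1#}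
    (R.trans {s ^ suc k} {1# ^ suc k} {1#} (^-congˡ (suc k) {s} {1#} s≋1) (1^n≋1 (suc k))))
  (R.*-identityˡ (H k))

module _ (t : Series) (ot : OrderAtLeast 1 t) where

  weighted : (ℕ → Series) → Series
  weighted c = ∑∞ (λ k → t ^ k * c k)

  weighted-summable : ∀ (c : ℕ → Series) → Summable (λ k → t ^ k * c k)
  weighted-summable c k = order-*ʳ (c k) (^-order ot k)

  weighted-first : ∀ (c : ℕ → Series) → weighted c ≋ c 0 + ∑∞ (λ k → t ^ suc k * c (suc k))
  weighted-first c = R.trans (∑∞-first {λ k → t ^ k * c k} (weighted-summable c))
    (R.+-congʳ {∑∞ (λ k → t ^ suc k * c (suc k))} (R.*-identityˡ (c 0)))

  weighted-A : weighted A ≋ Y + Y * F + t * (weighted A + (Y - 1#) * weighted B)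
  weighted-A = begin
    weighted A
      ≈⟨ weighted-first A ⟩
    A 0 + ∑∞ (λ k → t ^ suc k * A (suc k))
      ≈⟨ R.+-cong A-zero (∑∞-cong λ k →
           R.trans (R.*-congˡ {t ^ suc k} (A-suc k)) (regroup-A t (t ^ k) (A k) (Y - 1#) (B k))) ⟩
    Y + Y * F + ∑∞ (λ k → t * (t ^ k * A k) + t * (Y - 1#) * (t ^ k * B k))
      ≈⟨ R.+-congˡ {Y + Y * F} (∑∞-+ (λ k → t * (t ^ k * A k)) (λ k → t * (Y - 1#) * (t ^ k * B k))) ⟩
    Y + Y * F + (∑∞ (λ k → t * (t ^ k * A k)) + ∑∞ (λ k → t * (Y - 1#) * (t ^ k * B k)))
      ≈⟨ R.+-congˡ {Y + Y * F} (R.+-cong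
           (∑∞-* t {λ k → t ^ k * A k} (weighted-summable A)) (∑∞-* (t * (Y - 1#)) {λ k → t ^ k * B k} (weighted-summable B))) ⟩
    Y + Y * F + (t * weighted A + t * (Y - 1#) * weighted B)
      ≈⟨ R.+-congˡ {Y + Y * F} (R.+-congˡ {t * weighted A} (R.*-assoc t (Y - 1#) (weighted B))) ⟩
    Y + Y * F + (t * weighted A + t * ((Y - 1#) * weighted B))
      ≈⟨ R.+-congˡ {Y + Y * F} (R.distribˡ t (weighted A) ((Y - 1#) * weighted B)) ⟨
    Y + Y * F + t * (weighted A + (Y - 1#) * weighted B) ∎
    where open ≋-Reasoning

  weighted-B : weighted B ≋ Y + t * Y * weighted B + Y * Φ t
  weighted-B = begin
    weighted B
      ≈⟨ weighted-first B ⟩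
    B 0 + ∑∞ (λ k → t ^ suc k * B (suc k))
      ≈⟨ R.+-cong B-zero (∑∞-cong λ k →
           R.trans (R.*-congˡ {t ^ suc k} (B-suc k)) (regroup-B t (t ^ k) Y (B k) (H k))) ⟩
    Y + ∑∞ (λ k → t * Y * (t ^ k * B k) + Y * (t ^ suc k * H k))
      ≈⟨ R.+-congˡ {Y} (∑∞-+ (λ k → t * Y * (t ^ k * B k)) (λ k → Y * (t ^ suc k * H k))) ⟩
    Y + (∑∞ (λ k → t * Y * (t ^ k * B k)) + ∑∞ (λ k → Y * (t ^ suc k * H k)))
      ≈⟨ R.+-congˡ {Y} (R.+-cong
           (∑∞-* (t * Y) {λ k → t ^ k * B k} (weighted-summable B)) (∑∞-* Y {λ k → t ^ suc k * H k} (H-summable (λ k → t ^ suc k)))) ⟩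
    Y + (t * Y * weighted B + Y * Φ t)
      ≈⟨ R.+-assoc Y (t * Y * weighted B) (Y * Φ t) ⟨
    Y + t * Y * weighted B + Y * Φ t ∎
    where open ≋-Reasoning

  -- `T` and `A` differ only at k = 0, where the weight is t^0 = 1; hence the correction does not
  -- involve t.
  weighted-T : weighted T + Y * F ≋ weighted A
  weighted-T = begin
    weighted T + Y * F
      ≈⟨ R.+-congʳ {Y * F} (weighted-first T) ⟩
    T 0 + ∑∞ (λ k → t ^ suc k * T (suc k)) + Y * F
      ≈⟨ R.+-congʳ {Y * F} (R.+-cong (R.trans T-zero (R.*-identityʳ Y))
           (∑∞-cong λ k → R.*-congˡ {t ^ suc k} (T-suc k))) ⟩
    Y + ∑∞ (λ k → t ^ suc k * A (suc k)) + Y * F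
      ≈⟨ xy∙z≈xz∙y Y (∑∞ (λ k → t ^ suc k * A (suc k))) (Y * F) ⟩
    Y + Y * F + ∑∞ (λ k → t ^ suc k * A (suc k))
      ≈⟨ R.+-congʳ {∑∞ (λ k → t ^ suc k * A (suc k))} A-zero ⟨
    A 0 + ∑∞ (λ k → t ^ suc k * A (suc k))
      ≈⟨ weighted-first A ⟨
    weighted A ∎
    where open ≋-Reasoning

  -- The exponent `suc k` in `Φ` meets `Q ^ suc k` from `H≋`: together they give t^(k+1), of which
  -- one factor is taken out and t^k remains as weight.
  Φ-weighted : ∀ s → t ≋ s * Q → Φ s + X * t * (Y * F) ≋ X * t * weighted A
  Φ-weighted s t≋sQ = begin
    Φ s + X * t * (Y * F)
      ≈⟨ R.+-congʳ {X * t * (Y * F)} (∑∞-cong term) ⟩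
    ∑∞ (λ k → X * t * (t ^ k * T k)) + X * t * (Y * F)
      ≈⟨ R.+-congʳ {X * t * (Y * F)} (∑∞-* (X * t) {λ k → t ^ k * T k} (weighted-summable T)) ⟩
    X * t * weighted T + X * t * (Y * F)
      ≈⟨ R.distribˡ (X * t) (weighted T) (Y * F) ⟨
    X * t * (weighted T + Y * F)
      ≈⟨ R.*-congˡ {X * t} weighted-T ⟩
    X * t * weighted A ∎
    where
    open ≋-Reasoning
    term : ∀ k → s ^ suc k * H k ≋ X * t * (t ^ k * T k)
    term k = begin
      s ^ suc k * H k
        ≈⟨ R.*-congˡ {s ^ suc k} (H≋ k) ⟩
      s ^ suc k * (X * (Q ^ suc k * T k))
        ≈⟨ regroup-Φ X (s ^ suc k) (Q ^ suc k) (T k) ⟩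
      X * (s ^ suc k * Q ^ suc k * T k)
        ≈⟨ R.*-congˡ {X} (R.*-congʳ {T k} (R.trans {t ^ suc k} {(s * Q) ^ suc k} {s ^ suc k * Q ^ suc k}
             (^-congˡ (suc k) {t} {s * Q} t≋sQ) (^-distrib-* s Q (suc k)))) ⟨
      X * (t * t ^ k * T k)
        ≈⟨ R.*-congˡ {X} (R.*-assoc t (t ^ k) (T k)) ⟩
      X * (t * (t ^ k * T k))
        ≈⟨ R.*-assoc X t (t ^ k * T k) ⟨
      X * t * (t ^ k * T k) ∎

-- Iterating the functional equation

iteration : ∀ t s φ w → OrderAtLeast 1 t → t ≋ s * Q → Φ t ≡ φ → (1# - Y * t) * (1# - t) * w ≋ 1# →
  ∀ m m′ q q₁ q₂ ζ ζ′ p → m′ ≋ m * (X * Y) → q₁ ≋ q * t → q₂ ≋ q * (t * t) → ζ′ ≋ ζ * (Y - 1#) →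
  ∀ {P N D P′} → P ≋ m * q * ζ * p → N ≋ (m′ * q₁ * ζ) / (1# - Y * t) * p →
  D ≋ (m′ * q₂ * ζ) / (1# - t) * p → P′ ≋ m′ * q₂ * ζ′ * (p * w) →
  P * Φ s ≋ N + D * F + P′ * φ
iteration t s φ w ot t≋sQ refl uvw≋1 m m′ q q₁ q₂ ζ ζ′ p m′≋ q₁≋ q₂≋ ζ′≋ P≋ N≋ D≋ P′≋ =
  iterationStep {X} {Y} {Y - 1#} {t} {1# - Y * t} {1# - t}
    (sub-add Y 1#) (sub-add 1# (Y * t)) (sub-add 1# t)
    {F} {Φ s} {φ} {weighted t ot A} {weighted t ot B}
    (weighted-A t ot) (weighted-B t ot) (Φ-weighted t ot s t≋sQ)
    {(1# - Y * t) ⁻¹} {(1# - t) ⁻¹} {w}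
    (inverse (1# - Y * t) (1-order {Y * t} (order-*ˡ Y ot))) (inverse (1# - t) (1-order {t} ot)) uvw≋1
    {m} {m′} {q} {q₁} {q₂} {ζ} {ζ′} {p} m′≋ q₁≋ q₂≋ ζ′≋
    P≋ N≋ D≋ P′≋

-- The exponent ℓ(ℓ+1) is 2(1 + ... + ℓ), collected from the factors t² of the earlier steps. The
-- current step, with t = q^(ℓ+1), adds ℓ+1 in the numerator and 2(ℓ+1) in the denominator.
Q^-numerator : ∀ ℓ → Q ^ ((ℓ ℕ.+ 1) ℕ.^ 2) ≋ Q ^ (ℓ ℕ.* (ℓ ℕ.+ 1)) * Q ^ (ℓ ℕ.+ 1)
Q^-numerator ℓ = R.trans {Q ^ ((ℓ ℕ.+ 1) ℕ.^ 2)} {Q ^ (ℓ ℕ.* (ℓ ℕ.+ 1) ℕ.+ (ℓ ℕ.+ 1))}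
  (^-congʳ Q {(ℓ ℕ.+ 1) ℕ.^ 2} {ℓ ℕ.* (ℓ ℕ.+ 1) ℕ.+ (ℓ ℕ.+ 1)}
    (solve 1 (λ ℓ → (ℓ :+ con 1) :^ 2 := ℓ :* (ℓ :+ con 1) :+ (ℓ :+ con 1)) refl ℓ))
  (^-homo-* Q (ℓ ℕ.* (ℓ ℕ.+ 1)) (ℓ ℕ.+ 1))
  where open +-*-Solver using (solve; _:=_; _:+_; _:*_; _:^_; con)

Q^-denominator : ∀ ℓ → Q ^ ((ℓ ℕ.+ 1) ℕ.* (ℓ ℕ.+ 2)) ≋ Q ^ (ℓ ℕ.* (ℓ ℕ.+ 1)) * (Q ^ (ℓ ℕ.+ 1) * Q ^ (ℓ ℕ.+ 1))
Q^-denominator ℓ = begin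
  Q ^ ((ℓ ℕ.+ 1) ℕ.* (ℓ ℕ.+ 2))
    ≈⟨ ^-congʳ Q {(ℓ ℕ.+ 1) ℕ.* (ℓ ℕ.+ 2)} {ℓ ℕ.* (ℓ ℕ.+ 1) ℕ.+ ((ℓ ℕ.+ 1) ℕ.+ (ℓ ℕ.+ 1))}
         (solve 1 (λ ℓ → (ℓ :+ con 1) :* (ℓ :+ con 2) :=
           ℓ :* (ℓ :+ con 1) :+ ((ℓ :+ con 1) :+ (ℓ :+ con 1))) refl ℓ) ⟩
  Q ^ (ℓ ℕ.* (ℓ ℕ.+ 1) ℕ.+ ((ℓ ℕ.+ 1) ℕ.+ (ℓ ℕ.+ 1)))
    ≈⟨ ^-homo-* Q (ℓ ℕ.* (ℓ ℕ.+ 1)) ((ℓ ℕ.+ 1) ℕ.+ (ℓ ℕ.+ 1)) ⟩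
  Q ^ (ℓ ℕ.* (ℓ ℕ.+ 1)) * Q ^ ((ℓ ℕ.+ 1) ℕ.+ (ℓ ℕ.+ 1))
    ≈⟨ R.*-congˡ {Q ^ (ℓ ℕ.* (ℓ ℕ.+ 1))} {Q ^ ((ℓ ℕ.+ 1) ℕ.+ (ℓ ℕ.+ 1))} {Q ^ (ℓ ℕ.+ 1) * Q ^ (ℓ ℕ.+ 1)}
         (^-homo-* Q (ℓ ℕ.+ 1) (ℓ ℕ.+ 1)) ⟩
  Q ^ (ℓ ℕ.* (ℓ ℕ.+ 1)) * (Q ^ (ℓ ℕ.+ 1) * Q ^ (ℓ ℕ.+ 1)) ∎
  where
  open ≋-Reasoning
  open +-*-Solver using (solve; _:=_; _:+_; _:*_; con)

-- The F term and the new remainder carry the same t², so the denominator exponent is also that of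
-- the next `prefix`.
exponent-suc : ∀ ℓ → (ℓ ℕ.+ 1) ℕ.* (ℓ ℕ.+ 2) ≡ suc ℓ ℕ.* (suc ℓ ℕ.+ 1)
exponent-suc =
  solve 1 (λ ℓ → (ℓ :+ con 1) :* (ℓ :+ con 2) := (con 1 :+ ℓ) :* ((con 1 :+ ℓ) :+ con 1)) refl
  where open +-*-Solver using (solve; _:=_; _:+_; _:*_; con)

Q^-order : ∀ ℓ → OrderAtLeast 1 (Q ^ (ℓ ℕ.+ 1))
Q^-order ℓ = order-mono (ℕ.m≤n+m 1 ℓ) (^-order (order-constant {Q} refl) (ℓ ℕ.+ 1))

/-inverse : ∀ f → f 0 0 0 ≡ 1ℤ → f * (1# / f) ≋ 1#
/-inverse f f₀≡1 = R.trans {f * (1# / f)} {f * f ⁻¹} {1#}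
  (R.*-congˡ {f} {1# / f} {f ⁻¹} (R.*-identityˡ (f ⁻¹))) (inverse f f₀≡1)

factor : ℕ → Series
factor i = 1# / ((1# - Y * Q ^ (i ℕ.+ 1)) * (1# - Q ^ (i ℕ.+ 1)))

factor-inverse : ∀ ℓ → (1# - Y * Q ^ (ℓ ℕ.+ 1)) * (1# - Q ^ (ℓ ℕ.+ 1)) * factor ℓ ≋ 1#
factor-inverse ℓ = /-inverse ((1# - Y * Q ^ (ℓ ℕ.+ 1)) * (1# - Q ^ (ℓ ℕ.+ 1)))
  (*-constant (1# - Y * Q ^ (ℓ ℕ.+ 1)) (1# - Q ^ (ℓ ℕ.+ 1))
    (1-order {Y * Q ^ (ℓ ℕ.+ 1)} (order-*ˡ Y (Q^-order ℓ))) (1-order {Q ^ (ℓ ℕ.+ 1)} (Q^-order ℓ)))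

-- The coefficient of Φ (Q ^ ℓ) after ℓ iterations, with the factors in the
-- order in which they occur in numeratorTerm and denominatorTerm.
prefix : ℕ → Series
prefix ℓ = (X * Y) ^ ℓ * Q ^ (ℓ ℕ.* (ℓ ℕ.+ 1)) * (Y - 1#) ^ ℓ * commonProduct ℓ

prefix≋ : ∀ ℓ → prefix ℓ ≋ (X * Y) ^ ℓ * Q ^ (ℓ ℕ.* (ℓ ℕ.+ 1)) * (Y - 1#) ^ ℓ * commonProduct ℓ
prefix≋ ℓ = pointwise λ a b n → refl

numeratorTerm≋ : ∀ ℓ → numeratorTerm ℓ ≋
  ((X * Y) ^ (ℓ ℕ.+ 1) * Q ^ ((ℓ ℕ.+ 1) ℕ.^ 2) * (Y - 1#) ^ ℓ) / (1# - Y * Q ^ (ℓ ℕ.+ 1)) * commonProduct ℓ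
numeratorTerm≋ ℓ = pointwise λ a b n → refl

denominatorTerm≋ : ∀ ℓ → denominatorTerm ℓ ≋
  ((X * Y) ^ (ℓ ℕ.+ 1) * Q ^ ((ℓ ℕ.+ 1) ℕ.* (ℓ ℕ.+ 2)) * (Y - 1#) ^ ℓ) / (1# - Q ^ (ℓ ℕ.+ 1)) * commonProduct ℓ
denominatorTerm≋ ℓ = pointwise λ a b n → refl

commonProduct-∏ : ∀ ℓ → commonProduct ℓ ≋ ∏ ℓ factor
commonProduct-∏ ℓ = pointwise λ a b n → refl

∏-suc : ∀ n t → ∏ (suc n) t ≋ ∏ n t * t n
∏-suc n t = pointwise λ a b n → refl

commonProduct-suc : ∀ ℓ → commonProduct (suc ℓ) ≋ commonProduct ℓ * factor ℓ
commonProduct-suc ℓ = begin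
  commonProduct (suc ℓ)
    ≈⟨ commonProduct-∏ (suc ℓ) ⟩
  ∏ (suc ℓ) factor
    ≈⟨ ∏-suc ℓ factor ⟩
  ∏ ℓ factor * factor ℓ
    ≈⟨ R.*-congʳ {factor ℓ} {commonProduct ℓ} {∏ ℓ factor}
         (commonProduct-∏ ℓ) ⟨
  commonProduct ℓ * factor ℓ ∎
  where open ≋-Reasoning

prefix-suc : ∀ ℓ → prefix (suc ℓ) ≋
  (X * Y) ^ (ℓ ℕ.+ 1) * Q ^ ((ℓ ℕ.+ 1) ℕ.* (ℓ ℕ.+ 2)) * (Y - 1#) ^ suc ℓ * (commonProduct ℓ * factor ℓ)
prefix-suc ℓ = begin
  prefix (suc ℓ)
    ≈⟨ prefix≋ (suc ℓ) ⟩
  (X * Y) ^ suc ℓ * Q ^ (suc ℓ ℕ.* (suc ℓ ℕ.+ 1)) * (Y - 1#) ^ suc ℓ * commonProduct (suc ℓ)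
    ≈⟨ R.*-cong {(X * Y) ^ (ℓ ℕ.+ 1) * Q ^ ((ℓ ℕ.+ 1) ℕ.* (ℓ ℕ.+ 2)) * (Y - 1#) ^ suc ℓ}
         {(X * Y) ^ suc ℓ * Q ^ (suc ℓ ℕ.* (suc ℓ ℕ.+ 1)) * (Y - 1#) ^ suc ℓ}
         {commonProduct ℓ * factor ℓ} {commonProduct (suc ℓ)}
         (R.*-congʳ {(Y - 1#) ^ suc ℓ} {(X * Y) ^ (ℓ ℕ.+ 1) * Q ^ ((ℓ ℕ.+ 1) ℕ.* (ℓ ℕ.+ 2))}
           {(X * Y) ^ suc ℓ * Q ^ (suc ℓ ℕ.* (suc ℓ ℕ.+ 1))}
           (R.*-cong {(X * Y) ^ (ℓ ℕ.+ 1)} {(X * Y) ^ suc ℓ}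
             {Q ^ ((ℓ ℕ.+ 1) ℕ.* (ℓ ℕ.+ 2))} {Q ^ (suc ℓ ℕ.* (suc ℓ ℕ.+ 1))}
             (^-congʳ (X * Y) {ℓ ℕ.+ 1} {suc ℓ} (ℕ.+-comm ℓ 1))
             (^-congʳ Q {(ℓ ℕ.+ 1) ℕ.* (ℓ ℕ.+ 2)} {suc ℓ ℕ.* (suc ℓ ℕ.+ 1)} (exponent-suc ℓ))))
         (R.sym {commonProduct (suc ℓ)} (commonProduct-suc ℓ)) ⟨
  (X * Y) ^ (ℓ ℕ.+ 1) * Q ^ ((ℓ ℕ.+ 1) ℕ.* (ℓ ℕ.+ 2)) * (Y - 1#) ^ suc ℓ * (commonProduct ℓ * factor ℓ) ∎
  where open ≋-Reasoning

iterate : ∀ ℓ → prefix ℓ * Φ (Q ^ ℓ) ≋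
          numeratorTerm ℓ + denominatorTerm ℓ * F + prefix (suc ℓ) * Φ (Q ^ suc ℓ)
iterate ℓ = iteration (Q ^ (ℓ ℕ.+ 1)) (Q ^ ℓ) (Φ (Q ^ suc ℓ)) (factor ℓ) (Q^-order ℓ)
  (^-snoc Q ℓ) (cong (λ i → Φ (Q ^ i)) {ℓ ℕ.+ 1} {suc ℓ} (ℕ.+-comm ℓ 1)) (factor-inverse ℓ)
  ((X * Y) ^ ℓ) ((X * Y) ^ (ℓ ℕ.+ 1)) (Q ^ (ℓ ℕ.* (ℓ ℕ.+ 1))) (Q ^ ((ℓ ℕ.+ 1) ℕ.^ 2))
  (Q ^ ((ℓ ℕ.+ 1) ℕ.* (ℓ ℕ.+ 2))) ((Y - 1#) ^ ℓ) ((Y - 1#) ^ suc ℓ) (commonProduct ℓ)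
  (^-snoc (X * Y) ℓ) (Q^-numerator ℓ) (Q^-denominator ℓ) (R.*-comm (Y - 1#) ((Y - 1#) ^ ℓ))
  {prefix ℓ} {numeratorTerm ℓ} {denominatorTerm ℓ} {prefix (suc ℓ)}
  (prefix≋ ℓ) (numeratorTerm≋ ℓ) (denominatorTerm≋ ℓ) (prefix-suc ℓ)

-- Convergence of the iteration and the linear equation for F

XY^-order : ∀ k → OrderAtLeast k ((X * Y) ^ k)
XY^-order = ^-order (order-*ʳ Y (order-constant {X} refl))

order-prefix : ∀ {k f} m q ζ p → f ≋ m * q * ζ * p → OrderAtLeast k m → OrderAtLeast k f
order-prefix m q ζ p f≋ om = order-≋ f≋ (order-*ʳ p (order-*ʳ ζ (order-*ʳ q om)))

order-term : ∀ {k f} m q ζ v p → f ≋ (m * q * ζ) / v * p → OrderAtLeast k m → OrderAtLeast k f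
order-term m q ζ v p f≋ om = order-≋ f≋ (order-*ʳ p (order-*ʳ (v ⁻¹) (order-*ʳ ζ (order-*ʳ q om))))

remainder-summable : Summable (λ ℓ → prefix ℓ * Φ (Q ^ ℓ))
remainder-summable ℓ = order-*ʳ {f = prefix ℓ} (Φ (Q ^ ℓ))
  (order-prefix {f = prefix ℓ} ((X * Y) ^ ℓ) (Q ^ (ℓ ℕ.* (ℓ ℕ.+ 1))) ((Y - 1#) ^ ℓ) (commonProduct ℓ)
    (prefix≋ ℓ) (XY^-order ℓ))

-- Order ℓ + 1 and not just ℓ: the term for ℓ = 0 must also have no constant coefficient, so that
-- `1# - ∑∞ denominatorTerm` is invertible.
denominatorTerm-order : ∀ ℓ → OrderAtLeast (ℓ ℕ.+ 1) (denominatorTerm ℓ)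
denominatorTerm-order ℓ = order-term {f = denominatorTerm ℓ}
  ((X * Y) ^ (ℓ ℕ.+ 1)) (Q ^ ((ℓ ℕ.+ 1) ℕ.* (ℓ ℕ.+ 2))) ((Y - 1#) ^ ℓ) (1# - Q ^ (ℓ ℕ.+ 1)) (commonProduct ℓ)
  (denominatorTerm≋ ℓ) (XY^-order (ℓ ℕ.+ 1))

prefix-zero : prefix 0 ≋ 1#
prefix-zero = begin
  prefix 0           ≈⟨ prefix≋ 0 ⟩
  1# * 1# * 1# * 1#  ≈⟨ R.*-identityʳ (1# * 1# * 1#) ⟩
  1# * 1# * 1#       ≈⟨ R.*-identityʳ (1# * 1#) ⟩
  1# * 1#            ≈⟨ R.*-identityʳ 1# ⟩
  1#                 ∎
  where open ≋-Reasoning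

F-linear : F ≋ ∑∞ numeratorTerm + ∑∞ denominatorTerm * F
F-linear = begin
  F
    ≈⟨ Φ-one (Q ^ 0) (R.refl {1#}) ⟨
  Φ (Q ^ 0)
    ≈⟨ R.*-identityˡ (Φ (Q ^ 0)) ⟨
  1# * Φ (Q ^ 0)
    ≈⟨ R.*-congʳ {Φ (Q ^ 0)} {prefix 0} {1#} prefix-zero ⟨
  prefix 0 * Φ (Q ^ 0)
    ≈⟨ ∑∞-telescope {λ ℓ → numeratorTerm ℓ + denominatorTerm ℓ * F} {λ ℓ → prefix ℓ * Φ (Q ^ ℓ)}
         iterate remainder-summable ⟩
  ∑∞ (λ ℓ → numeratorTerm ℓ + denominatorTerm ℓ * F)
    ≈⟨ ∑∞-linear numeratorTerm denominatorTerm F (λ ℓ →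
         order-mono {f = denominatorTerm ℓ} (ℕ.m≤m+n ℓ 1) (denominatorTerm-order ℓ)) ⟩
  ∑∞ numeratorTerm + ∑∞ denominatorTerm * F ∎
  where open ≋-Reasoning

theorem2p1 : Σ[ F ∈ Series ]
    IsGeneratingFunction F ×
    F ≈ ∑∞ numeratorTerm / (1# - ∑∞ denominatorTerm)
theorem2p1 = F , F-isGeneratingFunction ,
  solve-linear (∑∞ numeratorTerm) (∑∞ denominatorTerm) F
    (∑∞-order {denominatorTerm} denominatorTerm-order) F-linear
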